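{- Let $p\ge 7$ be a prime and $k$ an integer with $(p+2)/3\le k\le p-3$. Then \[ k+1\le \mathsf{BO}(k,\mathbb{Z}/p\mathbb{Z})\le k+2. \]
   Context: For a positive integer $k$, a set $\{g_1,\dots,g_k\}$ of $k$ distinct elements of a finite abelian group $G$ (written additively) is called $k$-barycentric if $\sum_{i=1}^k g_i = k\,g_j$ for some $1\le j\le k$. The $k$-th barycentric Olson constant $\mathsf{BO}(k,G)$ is the smallest integer $\ell$ such that every subset $A\subseteq G$ with $|A|\ge \ell$ contains a $k$-barycentric subset (so that always $\mathsf{BO}(k,G)\le |G|+1$). -}

module Defs where

open import Algebra.Bundles using (AbelianGroup)
import Algebra.Definitions.RawMonoid as RawMonoidDefinitions
open import Data.Bool.Base using (if_then_else_)
open import Data.Fin.Base using (Fin; toℕ; fromℕ<)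
import Data.Fin.Properties as Fin
open import Data.Fin.Subset using (Subset; _∈_; _⊆_; ∣_∣)
open import Data.Fin.Subset.Properties using (_∈?_; _⊆?_; anySubset?; ∣p∣≤n)
open import Data.Integer.Base as ℤ using (ℤ; +_; _+_; _-_; -_; 0ℤ)
open import Data.Integer.DivMod using (_%ℕ_; _/ℕ_; n%ℕd<d; a≡a%ℕn+[a/ℕn]*n)
open import Data.Integer.Divisibility.Signed
  using (_∣_; divides; ∣m∣n⇒∣m+n; ∣m⇒∣-m; ∣⇒∣ᵤ)
import Data.Integer.Properties as ℤ
open import Data.Integer.Tactic.RingSolver using (solve-∀)
open import Data.Nat.Base as ℕ using (ℕ; zero; suc; _≤_; _<_; NonZero)
import Data.Nat.Divisibility as ℕ
import Data.Nat.Properties as ℕ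
open import Data.Product.Base using (∃-syntax; _×_; _,_; proj₁; proj₂)
open import Data.Sum.Base using (inj₁; inj₂)
open import Data.Vec.Base using (lookup)
open import Function.Bundles using (Inverse)
open import Level using (Level; 0ℓ) renaming (suc to lsuc; _⊔_ to _⊔ˡ_)
open import Relation.Binary.Definitions using () renaming (Decidable to Decidable₂)
open import Relation.Binary.PropositionalEquality
  using (_≡_; refl; sym; trans; cong; subst; setoid)
open import Relation.Nullary using (¬_; Dec; yes; no; contradiction)
open import Relation.Nullary.Decidable
  using (map′; ¬?; _×-dec_; _→-dec_; decidable-stable)
open import Relation.Unary using (Pred; Decidable)

private
  variable
    c ℓ : Level

------------------------------------------------------------------------
-- Least natural numbers

IsLeast : Pred ℕ ℓ → ℕ → Set ℓ
IsLeast P m = P m × (∀ n → P n → m ≤ n)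

least : {P : Pred ℕ ℓ} → Decidable P → ∀ n → P n → ∃[ m ] IsLeast P m
least {P = P} P? n Pn with P? 0
... | yes P0 = 0 , P0 , λ _ _ → ℕ.z≤n
least P? zero    Pn | no ¬P0 = contradiction Pn ¬P0
least {P = P} P? (suc n) Pn | no ¬P0
  with least {P = λ i → P (suc i)} (λ i → P? (suc i)) n Pn
... | m , Pm , minimal = suc m , Pm , bound
  where
  bound : ∀ i → P i → suc m ≤ i
  bound zero    P0 = contradiction P0 ¬P0
  bound (suc i) Pi = ℕ.s≤s (minimal i Pi)

------------------------------------------------------------------------
-- Finite abelian groups

-- The enumeration is auxiliary: it lets subsets of the group be given as
-- subsets of Fin order, so that the library's notion of cardinality applies.

record FiniteAbelianGroup c ℓ : Set (lsuc (c ⊔ˡ ℓ)) where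
  field
    abelianGroup : AbelianGroup c ℓ
    order        : ℕ
    enumeration  : Inverse (setoid (Fin order)) (AbelianGroup.setoid abelianGroup)

  open AbelianGroup abelianGroup public
  open RawMonoidDefinitions rawMonoid public
    using (sum) renaming (_×_ to _·_)

  element : Fin order → Carrier
  element = Inverse.to enumeration

  _≈?_ : Decidable₂ _≈_
  x ≈? y = map′ reflect (Inverse.from-cong enumeration)
             (Inverse.from enumeration x Fin.≟ Inverse.from enumeration y)
    where
    reflect : Inverse.from enumeration x ≡ Inverse.from enumeration y → x ≈ y
    reflect eq = AbelianGroup.trans abelianGroup
      (AbelianGroup.sym abelianGroup (Inverse.strictlyInverseˡ enumeration x))
      (Inverse.inverseˡ enumeration eq)

------------------------------------------------------------------------
-- The barycentric Olson constant

module _ (G : FiniteAbelianGroup c ℓ) where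

  private module G = FiniteAbelianGroup G

  ∑ : Subset G.order → G.Carrier
  ∑ B = G.sum λ i → if lookup B i then G.element i else G.ε

  -- B is the set {g₁ , … , gₖ}; having k elements, its gᵢ are distinct.
  IsBarycentric : ℕ → Subset G.order → Set ℓ
  IsBarycentric k B =
    ∣ B ∣ ≡ k × (∃[ j ] j ∈ B × ∑ B G.≈ k G.· G.element j)

  HasBarycentricSubset : ℕ → Subset G.order → Set ℓ
  HasBarycentricSubset k A = ∃[ B ] B ⊆ A × IsBarycentric k B

  Forces : ℕ → ℕ → Set ℓ
  Forces k m = ∀ (A : Subset G.order) → m ≤ ∣ A ∣ → HasBarycentricSubset k A

  hasBarycentricSubset? : ∀ k → Decidable (HasBarycentricSubset k)
  hasBarycentricSubset? k A = anySubset? λ B → (B ⊆? A) ×-dec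
    ((∣ B ∣ ℕ.≟ k) ×-dec
      Fin.any? λ j → (j ∈? B) ×-dec (∑ B G.≈? (k G.· G.element j)))

  forces? : ∀ k → Decidable (Forces k)
  forces? k m = map′
    (λ none A m≤A → decidable-stable (hasBarycentricSubset? k A)
      λ ¬has → none (A , m≤A , ¬has))
    (λ forces (A , m≤A , ¬has) → ¬has (forces A m≤A))
    (¬? (anySubset? λ A → (m ℕ.≤? ∣ A ∣) ×-dec ¬? (hasBarycentricSubset? k A)))

  -- Vacuously, as no subset has more than order elements.
  forces-1+order : ∀ k → Forces k (suc G.order)
  forces-1+order k A order<A = contradiction (∣p∣≤n A) (ℕ.<⇒≱ order<A)

  olson : ∀ k → ∃[ m ] IsLeast (Forces k) m
  olson k = least (forces? k) (suc G.order) (forces-1+order k)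

BO : ℕ → FiniteAbelianGroup c ℓ → ℕ
BO k G = proj₁ (olson G k)

BO-isLeast : ∀ k (G : FiniteAbelianGroup c ℓ) → IsLeast (Forces G k) (BO k G)
BO-isLeast k G = proj₂ (olson G k)

------------------------------------------------------------------------
-- The group ℤ/nℤ: integers up to congruence modulo n

infix 4 _≡_[mod_]

record _≡_[mod_] (x y : ℤ) (n : ℕ) : Set where
  constructor congruent
  field
    n∣x-y : + n ∣ x - y

open _≡_[mod_] public

module _ (n : ℕ) where

  private
    infix 4 _≈_
    _≈_ : ℤ → ℤ → Set
    x ≈ y = x ≡ y [mod n ]

    ≈-reflexive : ∀ {x y} → x ≡ y → x ≈ y
    ≈-reflexive {x} refl = congruent (divides 0ℤ (ℤ.+-inverseʳ x))

    ≈-sym : ∀ {x y} → x ≈ y → y ≈ x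
    ≈-sym {x} {y} (congruent d) =
      congruent (subst (+ n ∣_) (lemma x y) (∣m⇒∣-m d))
      where
      lemma : ∀ x y → - (x - y) ≡ y - x
      lemma = solve-∀

    ≈-trans : ∀ {x y z} → x ≈ y → y ≈ z → x ≈ z
    ≈-trans {x} {y} {z} (congruent d) (congruent e) =
      congruent (subst (+ n ∣_) (lemma x y z) (∣m∣n⇒∣m+n d e))
      where
      lemma : ∀ x y z → (x - y) + (y - z) ≡ x - z
      lemma = solve-∀

    +-cong : ∀ {x y u v} → x ≈ y → u ≈ v → x + u ≈ y + v
    +-cong {x} {y} {u} {v} (congruent d) (congruent e) =
      congruent (subst (+ n ∣_) (lemma x y u v) (∣m∣n⇒∣m+n d e))
      where
      lemma : ∀ x y u v → (x - y) + (u - v) ≡ (x + u) - (y + v)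
      lemma = solve-∀

    neg-cong : ∀ {x y} → x ≈ y → - x ≈ - y
    neg-cong {x} {y} (congruent d) =
      congruent (subst (+ n ∣_) (lemma x y) (∣m⇒∣-m d))
      where
      lemma : ∀ x y → - (x - y) ≡ - x - - y
      lemma = solve-∀

  ℤ/-abelianGroup : AbelianGroup 0ℓ 0ℓ
  ℤ/-abelianGroup = record
    { Carrier = ℤ
    ; _≈_     = λ x y → x ≡ y [mod n ]
    ; _∙_     = _+_
    ; ε       = 0ℤ
    ; _⁻¹     = -_
    ; isAbelianGroup = record
      { isGroup = record
        { isMonoid = record
          { isSemigroup = record
            { isMagma = record
              { isEquivalence = record
                { refl = ≈-reflexive refl ; sym = ≈-sym ; trans = ≈-trans }
              ; ∙-cong = +-cong
              }
            ; assoc = λ x y z → ≈-reflexive (ℤ.+-assoc x y z)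
            }
          ; identity = (λ x → ≈-reflexive (ℤ.+-identityˡ x))
                     , (λ x → ≈-reflexive (ℤ.+-identityʳ x))
          }
        ; inverse = (λ x → ≈-reflexive (ℤ.+-inverseˡ x))
                  , (λ x → ≈-reflexive (ℤ.+-inverseʳ x))
        ; ⁻¹-cong = neg-cong
        }
      ; comm = λ x y → ≈-reflexive (ℤ.+-comm x y)
      }
    }

  module _ .{{_ : NonZero n}} where

    private
      residue : ℤ → Fin n
      residue x = fromℕ< (n%ℕd<d x n)

      residue-≈ : ∀ x → + toℕ (residue x) ≈ x
      residue-≈ x = ≈-sym (congruent (divides (x /ℕ n) eq))
        where
        lemma : ∀ r q → (r + q) - r ≡ q
        lemma = solve-∀
        eq : x - + toℕ (residue x) ≡ (x /ℕ n) ℤ.* + n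
        eq = trans
          (cong (λ r → x - + r) (Fin.toℕ-fromℕ< (n%ℕd<d x n)))
          (trans (cong (_- + (x %ℕ n)) (a≡a%ℕn+[a/ℕn]*n x n))
                 (lemma (+ (x %ℕ n)) ((x /ℕ n) ℤ.* + n)))

      small-≤ : ∀ {a b} → a < n → b ≤ a → + a ≈ + b → a ≡ b
      small-≤ {a} {b} a<n b≤a (congruent d) =
        ℕ.≤-antisym (ℕ.m∸n≡0⇒m≤n (zero-of (a ℕ.∸ b) n∣a∸b a∸b<n)) b≤a
        where
        n∣a∸b : n ℕ.∣ a ℕ.∸ b
        n∣a∸b = subst (λ z → n ℕ.∣ ℤ.∣ z ∣)
          (trans (ℤ.m-n≡m⊖n a b) (ℤ.⊖-≥ b≤a)) (∣⇒∣ᵤ d)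
        a∸b<n : a ℕ.∸ b < n
        a∸b<n = ℕ.≤-<-trans (ℕ.m∸n≤m a b) a<n
        zero-of : ∀ m → n ℕ.∣ m → m < n → m ≡ 0
        zero-of zero    _   _   = refl
        zero-of (suc m) n∣m m<n = contradiction (ℕ.∣⇒≤ n∣m) (ℕ.<⇒≱ m<n)

      toℕ-injective : ∀ {i j : Fin n} → + toℕ i ≈ + toℕ j → i ≡ j
      toℕ-injective {i} {j} i≈j with ℕ.≤-total (toℕ j) (toℕ i)
      ... | inj₁ j≤i = Fin.toℕ-injective (small-≤ (Fin.toℕ<n i) j≤i i≈j)
      ... | inj₂ i≤j =
        sym (Fin.toℕ-injective (small-≤ (Fin.toℕ<n j) i≤j (≈-sym i≈j)))

    ℤ/_ℤ : FiniteAbelianGroup 0ℓ 0ℓ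
    ℤ/_ℤ = record
      { abelianGroup = ℤ/-abelianGroup
      ; order        = n
      ; enumeration  = record
        { to        = λ i → + toℕ i
        ; from      = residue
        ; to-cong   = λ { refl → ≈-reflexive refl }
        ; from-cong = λ {x} {y} x≈y → toℕ-injective
            (≈-trans (residue-≈ x) (≈-trans x≈y (≈-sym (residue-≈ y))))
        ; inverse   = (λ { {x} refl → residue-≈ x })
                    , (λ {i} {x} x≈i → toℕ-injective (≈-trans (residue-≈ x) x≈i))
        }
      }

{-# OPTIONS --safe #-}

-- Lower bound: a k-set whose mean is not one of its elements, namely a set
-- symmetric about c without c, or for odd k such a set around c + {-3 , 1 , 2}.
--
-- Upper bound, by the polynomial method of Alon, Nathanson and Ruzsa: let A
-- have k + 2 elements with sum σ.  Removing a and b leaves a set with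
-- barycentre c as soon as a + b + k c = σ, with a, b, c in A distinct.  If
-- there are no such a, b, c, then, with z standing for k c, the polynomial
--   (x - y)(k x - z)(k y - z) ∏ (x + y + z - σ - t),   1 ≤ t ≤ p - 1,
-- vanishes on A × A × k A, so its coefficient at any monomial xⁱ yʲ zˡ of top
-- degree i + j + l = p + 2 with i, j, l ≤ k + 1 vanishes.  Up to units this is
--   (i - j) (k² i j - k l (i + j - 1) + l (l - 1)).
-- For l = k + 1 there are two choices of (i , j) for which i ≠ j and the
-- second factors differ by 2 k² or 3 k², a contradiction.
-- Coefficients are read off with divided differences, whose denominators are
-- cleared, so that all identities hold exactly over ℤ.

module Submission where

open import Defs
open import Data.Bool.Base using (if_then_else_)
open import Data.Fin.Base using (Fin; zero; suc; toℕ; fromℕ; inject₁)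
import Data.Fin.Properties as Fin
open import Data.Fin.Subset using (Subset; inside; outside; _∈_; _⊆_; ∣_∣)
open import Data.Fin.Subset.Properties
  using (out⊆; s⊆s; drop-∷-⊆; p⊆q⇒∣p∣≤∣q∣; ⊆-trans)
open import Data.Integer.Base using (ℤ; +_; _+_; _*_; _-_; -_; _^_; 0ℤ; 1ℤ)
open import Data.Integer.DivMod using (_%ℕ_; _/ℕ_; n%ℕd<d; a≡a%ℕn+[a/ℕn]*n)
open import Data.Integer.Divisibility.Signed
  using (_∣_; divides; ∣m∣n⇒∣m+n; ∣m∣n⇒∣m-n; ∣m⇒∣-m; ∣n⇒∣m*n; ∣m⇒∣m*n;
         ∣⇒∣ᵤ; ∣ᵤ⇒∣; _∣?_)
import Data.Integer.Properties as ℤ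
open import Data.Integer.Tactic.RingSolver using (solve-∀)
open import Data.List.Base using (List; []; _∷_; map; length)
open import Data.List.Membership.Propositional renaming (_∈_ to _∈ₗ_)
open import Data.List.Membership.Propositional.Properties using (∈-map⁻)
import Data.List.Properties as List
open import Data.List.Relation.Unary.All as All using (All; []; _∷_)
import Data.List.Relation.Unary.All.Properties as All
open import Data.List.Relation.Unary.AllPairs as AllPairs using (AllPairs; []; _∷_)
import Data.List.Relation.Unary.AllPairs.Properties as AllPairs
open import Data.Nat.Base as ℕ using (ℕ; zero; suc; z≤n; s≤s; _!; NonZero)
import Data.Nat.Divisibility as ℕ
open import Data.Nat.DivMod using (_/_; _%_; m%n<n; m≡m%n+[m/n]*n)
open import Data.Nat.Primality
  using (Prime; euclidsLemma; prime⇒nonTrivial; prime⇒irreducible)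
import Data.Nat.Properties as ℕ
import Data.Nat.Tactic.RingSolver as ℕ-Solver
open import Data.Product.Base using (_×_; _,_; proj₁; ∃-syntax)
open import Data.Sum.Base using (_⊎_; inj₁; inj₂)
import Data.Vec.Functional as Vector
open import Data.Vec.Base using ([]; _∷_; _∷ʳ_; lookup; here; there; _[_]≔_; _[_]=_)
open import Data.Vec.Properties using ([]≔-minimal; []=-injective)
open import Function.Base using (_∘_)
open import Function.Bundles using (Inverse)
open import Relation.Binary.PropositionalEquality
open import Relation.Nullary using (¬_; yes; no; contradiction)
open import Relation.Nullary.Decidable using (decidable-stable)
open ≡-Reasoning

private
  variable
    n : ℕ

-- Finitely supported linear functionals

Functional : Set
Functional = List (ℤ × ℤ)

⟨_⟩ : Functional → (ℤ → ℤ) → ℤ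
⟨ [] ⟩ f = 0ℤ
⟨ (x , w) ∷ W ⟩ f = w * f x + ⟨ W ⟩ f

points : Functional → List ℤ
points = map proj₁

⟨⟩-cong : ∀ W {f g} → (∀ x → f x ≡ g x) → ⟨ W ⟩ f ≡ ⟨ W ⟩ g
⟨⟩-cong []            f≗g = refl
⟨⟩-cong ((x , w) ∷ W) f≗g = cong₂ _+_ (cong (w *_) (f≗g x)) (⟨⟩-cong W f≗g)

⟨⟩-+ : ∀ W f g → ⟨ W ⟩ (λ x → f x + g x) ≡ ⟨ W ⟩ f + ⟨ W ⟩ g
⟨⟩-+ []            f g = refl
⟨⟩-+ ((x , w) ∷ W) f g = begin
  w * (f x + g x) + ⟨ W ⟩ (λ x → f x + g x)       ≡⟨ cong (λ s → w * (f x + g x) + s) (⟨⟩-+ W f g) ⟩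
  w * (f x + g x) + (⟨ W ⟩ f + ⟨ W ⟩ g)           ≡⟨ lemma w (f x) (g x) _ _ ⟩
  (w * f x + ⟨ W ⟩ f) + (w * g x + ⟨ W ⟩ g)       ∎
  where
  lemma : ∀ w a b c d → w * (a + b) + (c + d) ≡ (w * a + c) + (w * b + d)
  lemma = solve-∀

⟨⟩-*ˡ : ∀ W c f → ⟨ W ⟩ (λ x → c * f x) ≡ c * ⟨ W ⟩ f
⟨⟩-*ˡ []            c f = sym (ℤ.*-zeroʳ c)
⟨⟩-*ˡ ((x , w) ∷ W) c f = begin
  w * (c * f x) + ⟨ W ⟩ (λ x → c * f x)  ≡⟨ cong (λ s → w * (c * f x) + s) (⟨⟩-*ˡ W c f) ⟩
  w * (c * f x) + c * ⟨ W ⟩ f            ≡⟨ lemma w c (f x) _ ⟩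
  c * (w * f x + ⟨ W ⟩ f)                ∎
  where
  lemma : ∀ w c a b → w * (c * a) + c * b ≡ c * (w * a + b)
  lemma = solve-∀

⟨⟩-*ʳ : ∀ W f c → ⟨ W ⟩ (λ x → f x * c) ≡ ⟨ W ⟩ f * c
⟨⟩-*ʳ W f c = begin
  ⟨ W ⟩ (λ x → f x * c)  ≡⟨ ⟨⟩-cong W (λ x → ℤ.*-comm (f x) c) ⟩
  ⟨ W ⟩ (λ x → c * f x)  ≡⟨ ⟨⟩-*ˡ W c f ⟩
  c * ⟨ W ⟩ f            ≡⟨ ℤ.*-comm c _ ⟩
  ⟨ W ⟩ f * c            ∎

scale : ℤ → Functional → Functional
scale c = map λ (x , w) → x , c * w

⟨scale⟩ : ∀ c W f → ⟨ scale c W ⟩ f ≡ c * ⟨ W ⟩ f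
⟨scale⟩ c []            f = sym (ℤ.*-zeroʳ c)
⟨scale⟩ c ((x , w) ∷ W) f = begin
  (c * w) * f x + ⟨ scale c W ⟩ f  ≡⟨ cong₂ _+_ (ℤ.*-assoc c w (f x)) (⟨scale⟩ c W f) ⟩
  c * (w * f x) + c * ⟨ W ⟩ f      ≡⟨ ℤ.*-distribˡ-+ c (w * f x) (⟨ W ⟩ f) ⟨
  c * (w * f x + ⟨ W ⟩ f)          ∎

points-scale : ∀ c W → points (scale c W) ≡ points W
points-scale c W = sym (List.map-∘ W)

nodal : ℤ → List ℤ → ℤ
nodal a []       = 1ℤ
nodal a (x ∷ xs) = (x - a) * nodal a xs

-- The weights w / (x - a), cleared of denominators.
divideBy : ℤ → Functional → Functional
divideBy a []            = []
divideBy a ((x , w) ∷ W) = (x , w * nodal a (points W)) ∷ scale (x - a) (divideBy a W)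

-- The new weight at a point carries the differences `y - a` of all the other points, so the factor
-- `x - a` completes it to the same `nodal` product everywhere, which then factors out.
⟨divideBy⟩ : ∀ a W f →
  ⟨ divideBy a W ⟩ (λ x → (x - a) * f x) ≡ nodal a (points W) * ⟨ W ⟩ f
⟨divideBy⟩ a []            f = refl
⟨divideBy⟩ a ((x , w) ∷ W) f = begin
  (w * c) * ((x - a) * f x) + ⟨ scale (x - a) (divideBy a W) ⟩ g
    ≡⟨ cong (λ s → (w * c) * ((x - a) * f x) + s) (⟨scale⟩ (x - a) (divideBy a W) g) ⟩
  (w * c) * ((x - a) * f x) + (x - a) * ⟨ divideBy a W ⟩ g
    ≡⟨ cong (λ s → (w * c) * ((x - a) * f x) + (x - a) * s) (⟨divideBy⟩ a W f) ⟩
  (w * c) * ((x - a) * f x) + (x - a) * (c * ⟨ W ⟩ f)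
    ≡⟨ lemma w c (x - a) (f x) _ ⟩
  ((x - a) * c) * (w * f x + ⟨ W ⟩ f) ∎
  where
  c = nodal a (points W)
  g = λ x → (x - a) * f x
  lemma : ∀ w c d y s → (w * c) * (d * y) + d * (c * s) ≡ (d * c) * (w * y + s)
  lemma = solve-∀

points-divideBy : ∀ a W → points (divideBy a W) ≡ points W
points-divideBy a []            = refl
points-divideBy a ((x , w) ∷ W) = cong (x ∷_)
  (trans (points-scale (x - a) (divideBy a W)) (points-divideBy a W))

-- The divided difference at a ∷ as, times (length as) ! and a product of
-- differences of the points that clears the denominators.
dividedDifference : ℤ → List ℤ → Functional
dividedDifference a []       = (a , 1ℤ) ∷ []
dividedDifference a (b ∷ bs) = (a , - ⟨ W ⟩ (λ _ → 1ℤ)) ∷ W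
  where W = scale (+ suc (length bs)) (divideBy a (dividedDifference b bs))

points-dividedDifference : ∀ a as → points (dividedDifference a as) ≡ a ∷ as
points-dividedDifference a []       = refl
points-dividedDifference a (b ∷ bs) = cong (a ∷_) (begin
  points (scale (+ suc (length bs)) (divideBy a W))  ≡⟨ points-scale (+ suc (length bs)) (divideBy a W) ⟩
  points (divideBy a W)                              ≡⟨ points-divideBy a W ⟩
  points W                                           ≡⟨ points-dividedDifference b bs ⟩
  b ∷ bs                                             ∎)
  where W = dividedDifference b bs

vandermonde : ℤ → List ℤ → ℤ
vandermonde a []       = 1ℤ
vandermonde a (b ∷ bs) = nodal a (b ∷ bs) * vandermonde b bs

module _ (a b : ℤ) (bs : List ℤ) where
  private
    W = dividedDifference b bs
    N = + suc (length bs)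
    U = scale N (divideBy a W)
    T = dividedDifference a (b ∷ bs)

  -- The weight at `a` was chosen as minus the sum of all the others exactly for this.
  dividedDifference-1 : ⟨ T ⟩ (_^ 0) ≡ 0ℤ
  dividedDifference-1 = lemma (⟨ U ⟩ (λ _ → 1ℤ))
    where
    lemma : ∀ s → - s * 1ℤ + s ≡ 0ℤ
    lemma = solve-∀

  -- Write `x` as `a + (x - a)`. In the second part the point `a` drops out and `⟨divideBy⟩` cancels
  -- the factor, leaving the functional with one point fewer. This is the usual recursion for
  -- divided differences.
  dividedDifference-suc : ∀ j →
    ⟨ T ⟩ (_^ suc j) ≡ a * ⟨ T ⟩ (_^ j) + N * (nodal a (b ∷ bs) * ⟨ W ⟩ (_^ j))
  dividedDifference-suc j = begin
    ⟨ T ⟩ (_^ suc j)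
      ≡⟨ ⟨⟩-cong T (λ x → shift x a (x ^ j)) ⟩
    ⟨ T ⟩ (λ x → a * x ^ j + (x - a) * x ^ j)
      ≡⟨ ⟨⟩-+ T _ _ ⟩
    ⟨ T ⟩ (λ x → a * x ^ j) + ⟨ T ⟩ (λ x → (x - a) * x ^ j)
      ≡⟨ cong₂ _+_ (⟨⟩-*ˡ T a (_^ j))
           (drop (- ⟨ U ⟩ (λ _ → 1ℤ)) a (a ^ j) (⟨ U ⟩ λ x → (x - a) * x ^ j)) ⟩
    a * ⟨ T ⟩ (_^ j) + ⟨ U ⟩ (λ x → (x - a) * x ^ j)
      ≡⟨ cong (λ s → a * ⟨ T ⟩ (_^ j) + s) (⟨scale⟩ N (divideBy a W) _) ⟩
    a * ⟨ T ⟩ (_^ j) + N * ⟨ divideBy a W ⟩ (λ x → (x - a) * x ^ j)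
      ≡⟨ cong (λ s → a * ⟨ T ⟩ (_^ j) + N * s) (⟨divideBy⟩ a W (_^ j)) ⟩
    a * ⟨ T ⟩ (_^ j) + N * (nodal a (points W) * ⟨ W ⟩ (_^ j))
      ≡⟨ cong (λ ps → a * ⟨ T ⟩ (_^ j) + N * (nodal a ps * ⟨ W ⟩ (_^ j)))
              (points-dividedDifference b bs) ⟩
    a * ⟨ T ⟩ (_^ j) + N * (nodal a (b ∷ bs) * ⟨ W ⟩ (_^ j)) ∎
    where
    shift : ∀ x a y → x * y ≡ a * y + (x - a) * y
    shift = solve-∀
    drop : ∀ w a y s → w * ((a - a) * y) + s ≡ s
    drop = solve-∀

dividedDifference-low : ∀ a as j → j ℕ.< length as →
  ⟨ dividedDifference a as ⟩ (_^ j) ≡ 0ℤ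
dividedDifference-low a (b ∷ bs) zero    _         = dividedDifference-1 a b bs
dividedDifference-low a (b ∷ bs) (suc j) (s≤s j<d)
  rewrite dividedDifference-suc a b bs j
        | dividedDifference-low a (b ∷ bs) j (ℕ.m<n⇒m<1+n j<d)
        | dividedDifference-low b bs j j<d = lemma a (+ suc (length bs)) (nodal a (b ∷ bs))
  where
  lemma : ∀ a n c → a * 0ℤ + n * (c * 0ℤ) ≡ 0ℤ
  lemma = solve-∀

-- In the recursion the first summand is a low moment and vanishes. The second contributes one row
-- of the Vandermonde product and one factor of the factorial.
dividedDifference-top : ∀ a as →
  ⟨ dividedDifference a as ⟩ (_^ length as) ≡ vandermonde a as * + (length as !)
dividedDifference-top a []       = refl
dividedDifference-top a (b ∷ bs) = begin
  ⟨ dividedDifference a (b ∷ bs) ⟩ (_^ suc d)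
    ≡⟨ dividedDifference-suc a b bs d ⟩
  a * ⟨ dividedDifference a (b ∷ bs) ⟩ (_^ d)
    + + suc d * (c * ⟨ dividedDifference b bs ⟩ (_^ d))
    ≡⟨ cong₂ (λ s t → a * s + + suc d * (c * t))
         (dividedDifference-low a (b ∷ bs) d (ℕ.n<1+n d))
         (dividedDifference-top b bs) ⟩
  a * 0ℤ + + suc d * (c * (vandermonde b bs * + (d !)))
    ≡⟨ lemma a (+ suc d) c (vandermonde b bs) (+ (d !)) ⟩
  c * vandermonde b bs * (+ suc d * + (d !))
    ≡⟨ cong (c * vandermonde b bs *_) (ℤ.pos-* (suc d) (d !)) ⟨
  c * vandermonde b bs * + (suc d !) ∎
  where
  c = nodal a (b ∷ bs)
  d = length bs
  lemma : ∀ a n c v f → a * 0ℤ + n * (c * (v * f)) ≡ (c * v) * (n * f)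
  lemma = solve-∀

-- Falling factorials

infix 8 _↓_

_↓_ : ℕ → ℕ → ℤ
n     ↓ zero  = 1ℤ
zero  ↓ suc a = 0ℤ
suc n ↓ suc a = + suc n * n ↓ a

-- The definition peels off the largest factor, this the smallest. It needs no bound on `a`: at
-- `a = n` the new factor is zero, and beyond that `n ↓ a` already is.
↓-suc : ∀ n a → n ↓ suc a ≡ n ↓ a * (+ n - + a)
↓-suc zero    zero    = refl
↓-suc zero    (suc a) = refl
↓-suc (suc n) zero    = lemma (+ n)
  where
  lemma : ∀ n → (1ℤ + n) * 1ℤ ≡ 1ℤ * ((1ℤ + n) - 0ℤ)
  lemma = solve-∀
↓-suc (suc n) (suc a) = begin
  + suc n * n ↓ suc a                      ≡⟨ cong (+ suc n *_) (↓-suc n a) ⟩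
  + suc n * (n ↓ a * (+ n - + a))          ≡⟨ lemma (+ n) (+ a) (n ↓ a) ⟩
  (+ suc n * n ↓ a) * (+ suc n - + suc a)  ∎
  where
  lemma : ∀ n a f → (1ℤ + n) * (f * (n - a)) ≡ ((1ℤ + n) * f) * ((1ℤ + n) - (1ℤ + a))
  lemma = solve-∀

↓-self : ∀ n → n ↓ n ≡ + (n !)
↓-self zero    = refl
↓-self (suc n) = trans (cong (+ suc n *_) (↓-self n)) (sym (ℤ.pos-* (suc n) (n !)))

n<a⇒n↓a≡0 : ∀ {n a} → n ℕ.< a → n ↓ a ≡ 0ℤ
n<a⇒n↓a≡0 {zero}  {suc a} _         = refl
n<a⇒n↓a≡0 {suc n} {suc a} (s≤s n<a) =
  trans (cong (+ suc n *_) (n<a⇒n↓a≡0 n<a)) (ℤ.*-zeroʳ (+ suc n))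

-- With `n = p - 1` this plays the role of `1 - s ^ (p - 1)`: modulo `p` it vanishes unless `p`
-- divides `s`.
residueProduct : ℕ → ℤ → ℤ
residueProduct zero    s = 1ℤ
residueProduct (suc n) s = residueProduct n s * (s - + suc n)

-- The moments of a product of three functionals

-- On polynomials of degree at most `d` such a functional reads off the coefficient of degree `d`,
-- times `τ` and `d !`. The factorial appears as `d ↓ d` to match the falling factorials in the
-- moments below.
record IsTop (d : ℕ) (τ : ℤ) (W : Functional) : Set where
  field
    low : ∀ j → j ℕ.< d → ⟨ W ⟩ (_^ j) ≡ 0ℤ
    top : ⟨ W ⟩ (_^ d) ≡ τ * d ↓ d

dividedDifference-isTop : ∀ a as →
  IsTop (length as) (vandermonde a as) (dividedDifference a as)
dividedDifference-isTop a as = record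
  { low = dividedDifference-low a as
  ; top = trans (dividedDifference-top a as)
                (cong (vandermonde a as *_) (sym (↓-self (length as))))
  }

private
  sum₃-≤-split : ∀ a b c i j l → a ℕ.+ b ℕ.+ c ℕ.≤ i ℕ.+ j ℕ.+ l →
    (a ≡ i × b ≡ j × c ≡ l) ⊎ (a ℕ.< i ⊎ b ℕ.< j ⊎ c ℕ.< l)
  sum₃-≤-split a b c i j l le with a ℕ.<? i | b ℕ.<? j | c ℕ.<? l
  ... | yes a<i | _       | _       = inj₂ (inj₁ a<i)
  ... | no _    | yes b<j | _       = inj₂ (inj₂ (inj₁ b<j))
  ... | no _    | no _    | yes c<l = inj₂ (inj₂ (inj₂ c<l))
  ... | no a≮i  | no b≮j  | no c≮l
    with ℕ.m≤n⇒m<n∨m≡n (ℕ.≮⇒≥ a≮i)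
       | ℕ.m≤n⇒m<n∨m≡n (ℕ.≮⇒≥ b≮j)
       | ℕ.m≤n⇒m<n∨m≡n (ℕ.≮⇒≥ c≮l)
  ... | inj₁ i<a  | _         | _         = contradiction le
    (ℕ.<⇒≱ (ℕ.+-mono-<-≤ (ℕ.+-mono-<-≤ i<a (ℕ.≮⇒≥ b≮j)) (ℕ.≮⇒≥ c≮l)))
  ... | inj₂ _    | inj₁ j<b  | _         = contradiction le
    (ℕ.<⇒≱ (ℕ.+-mono-<-≤ (ℕ.+-mono-≤-< (ℕ.≮⇒≥ a≮i) j<b) (ℕ.≮⇒≥ c≮l)))
  ... | inj₂ _    | inj₂ _    | inj₁ l<c  = contradiction le
    (ℕ.<⇒≱ (ℕ.+-mono-≤-< (ℕ.+-mono-≤ (ℕ.≮⇒≥ a≮i) (ℕ.≮⇒≥ b≮j)) l<c))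
  ... | inj₂ i≡a  | inj₂ j≡b  | inj₂ l≡c  = inj₁ (sym i≡a , sym j≡b , sym l≡c)

  -- Distinct triples with equal sums differ in both directions. The entry that is too small kills a
  -- moment, the one that is too large kills a falling factorial, so the two sides of the base case
  -- of `moment-top` vanish together.
  sum₃-≡-split : ∀ a b c i j l → a ℕ.+ b ℕ.+ c ≡ i ℕ.+ j ℕ.+ l →
    (a ≡ i × b ≡ j × c ≡ l) ⊎
    (a ℕ.< i ⊎ b ℕ.< j ⊎ c ℕ.< l) × (i ℕ.< a ⊎ j ℕ.< b ⊎ l ℕ.< c)
  sum₃-≡-split a b c i j l eq
    with sum₃-≤-split a b c i j l (ℕ.≤-reflexive eq)
       | sum₃-≤-split i j l a b c (ℕ.≤-reflexive (sym eq))
  ... | inj₁ equal | _                        = inj₁ equal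
  ... | inj₂ _     | inj₁ (i≡a , j≡b , l≡c)   = inj₁ (sym i≡a , sym j≡b , sym l≡c)
  ... | inj₂ small | inj₂ large               = inj₂ (small , large)

  shift₁ : ∀ a b c n → a ℕ.+ b ℕ.+ c ℕ.+ suc n ≡ suc a ℕ.+ b ℕ.+ c ℕ.+ n
  shift₁ = ℕ-Solver.solve-∀

  shift₂ : ∀ a b c n → a ℕ.+ b ℕ.+ c ℕ.+ suc n ≡ a ℕ.+ suc b ℕ.+ c ℕ.+ n
  shift₂ = ℕ-Solver.solve-∀

  shift₃ : ∀ a b c n → a ℕ.+ b ℕ.+ c ℕ.+ suc n ≡ a ℕ.+ b ℕ.+ suc c ℕ.+ n
  shift₃ = ℕ-Solver.solve-∀

module Moments
  (X Y Z : Functional) {i j l : ℕ} {τ₁ τ₂ τ₃ : ℤ}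
  (X-top : IsTop i τ₁ X) (Y-top : IsTop j τ₂ Y) (Z-top : IsTop l τ₃ Z)
  (σ : ℤ)
  where

  private
    module X = IsTop X-top
    module Y = IsTop Y-top
    module Z = IsTop Z-top

  Λ : (ℤ → ℤ → ℤ → ℤ) → ℤ
  Λ f = ⟨ X ⟩ λ x → ⟨ Y ⟩ λ y → ⟨ Z ⟩ λ z → f x y z

  Λ-cong : ∀ {f g} → (∀ x y z → f x y z ≡ g x y z) → Λ f ≡ Λ g
  Λ-cong f≗g = ⟨⟩-cong X λ x → ⟨⟩-cong Y λ y → ⟨⟩-cong Z λ z → f≗g x y z

  Λ-+ : ∀ f g → Λ (λ x y z → f x y z + g x y z) ≡ Λ f + Λ g
  Λ-+ f g = trans
    (⟨⟩-cong X λ x → trans (⟨⟩-cong Y λ y → ⟨⟩-+ Z _ _) (⟨⟩-+ Y _ _))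
    (⟨⟩-+ X _ _)

  Λ-*ˡ : ∀ c f → Λ (λ x y z → c * f x y z) ≡ c * Λ f
  Λ-*ˡ c f = trans
    (⟨⟩-cong X λ x → trans (⟨⟩-cong Y λ y → ⟨⟩-*ˡ Z c _) (⟨⟩-*ˡ Y c _))
    (⟨⟩-*ˡ X c _)

  Λ-+* : ∀ f c g {s} → Λ f ≡ s → Λ (λ x y z → f x y z + c * g x y z) ≡ s + c * Λ g
  Λ-+* f c g Λf≡s = trans (Λ-+ f (λ x y z → c * g x y z)) (cong₂ _+_ Λf≡s (Λ-*ˡ c g))

  Λ-product : ∀ f g h →
    Λ (λ x y z → f x * g y * h z) ≡ ⟨ X ⟩ f * ⟨ Y ⟩ g * ⟨ Z ⟩ h
  Λ-product f g h = begin
    Λ (λ x y z → f x * g y * h z)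
      ≡⟨ ⟨⟩-cong X (λ x → ⟨⟩-cong Y λ y → ⟨⟩-*ˡ Z (f x * g y) h) ⟩
    ⟨ X ⟩ (λ x → ⟨ Y ⟩ λ y → f x * g y * ⟨ Z ⟩ h)
      ≡⟨ ⟨⟩-cong X (λ x → trans (⟨⟩-*ʳ Y _ (⟨ Z ⟩ h)) (cong (_* ⟨ Z ⟩ h) (⟨⟩-*ˡ Y (f x) g))) ⟩
    ⟨ X ⟩ (λ x → f x * ⟨ Y ⟩ g * ⟨ Z ⟩ h)
      ≡⟨ trans (⟨⟩-*ʳ X _ (⟨ Z ⟩ h)) (cong (_* ⟨ Z ⟩ h) (⟨⟩-*ʳ X f (⟨ Y ⟩ g))) ⟩
    ⟨ X ⟩ f * ⟨ Y ⟩ g * ⟨ Z ⟩ h ∎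

  monomial : ℕ → ℕ → ℕ → ℤ → ℤ → ℤ → ℤ
  monomial a b c x y z = x ^ a * y ^ b * z ^ c

  moment : ℕ → ℕ → ℕ → ℕ → ℤ
  moment n a b c = Λ λ x y z → monomial a b c x y z * residueProduct n (x + y + z - σ)

  -- Multiplying out the last linear factor trades it for one more power of `x`, `y` or `z`, or for
  -- a constant, which lowers the total degree.
  moment-suc : ∀ n a b c → moment (suc n) a b c ≡
    (moment n (suc a) b c + moment n a (suc b) c + moment n a b (suc c))
    + - (σ + + suc n) * moment n a b c
  moment-suc n a b c = begin
    moment (suc n) a b c
      ≡⟨ Λ-cong (λ x y z → expand x y z (x ^ a) (y ^ b) (z ^ c) _ σ (+ suc n)) ⟩
    Λ (λ x y z → f x y z + g x y z + h x y z + - (σ + + suc n) * k x y z)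
      ≡⟨ trans (Λ-+ _ _) (cong₂ _+_ (trans (Λ-+ _ h) (cong (_+ Λ h) (Λ-+ f g)))
           (Λ-*ˡ (- (σ + + suc n)) k)) ⟩
    (Λ f + Λ g + Λ h) + - (σ + + suc n) * Λ k ∎
    where
    r = λ x y z → residueProduct n (x + y + z - σ)
    f g h k : ℤ → ℤ → ℤ → ℤ
    f x y z = monomial (suc a) b c x y z * r x y z
    g x y z = monomial a (suc b) c x y z * r x y z
    h x y z = monomial a b (suc c) x y z * r x y z
    k x y z = monomial a b c x y z * r x y z
    expand : ∀ x y z A B C R s t → A * B * C * (R * (x + y + z - s - t)) ≡
      (((x * A) * B * C * R + A * (y * B) * C * R) + A * B * (z * C) * R)
      + - (s + t) * (A * B * C * R)
    expand = solve-∀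

  moment-0 : ∀ a b c → moment 0 a b c ≡ ⟨ X ⟩ (_^ a) * ⟨ Y ⟩ (_^ b) * ⟨ Z ⟩ (_^ c)
  moment-0 a b c = trans
    (Λ-cong λ x y z → ℤ.*-identityʳ (monomial a b c x y z))
    (Λ-product (_^ a) (_^ b) (_^ c))

  private
    Λ-zero : ∀ a b c → a ℕ.< i ⊎ b ℕ.< j ⊎ c ℕ.< l → moment 0 a b c ≡ 0ℤ
    Λ-zero a b c small = trans (moment-0 a b c) (vanish small)
      where
      vanish : a ℕ.< i ⊎ b ℕ.< j ⊎ c ℕ.< l →
               ⟨ X ⟩ (_^ a) * ⟨ Y ⟩ (_^ b) * ⟨ Z ⟩ (_^ c) ≡ 0ℤ
      vanish (inj₁ a<i) rewrite X.low a a<i = refl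
      vanish (inj₂ (inj₁ b<j)) rewrite Y.low b b<j
        = cong (_* ⟨ Z ⟩ (_^ c)) (ℤ.*-zeroʳ (⟨ X ⟩ (_^ a)))
      vanish (inj₂ (inj₂ c<l)) rewrite Z.low c c<l
        = ℤ.*-zeroʳ (⟨ X ⟩ (_^ a) * ⟨ Y ⟩ (_^ b))

    ↓-zero : ∀ a b c → i ℕ.< a ⊎ j ℕ.< b ⊎ l ℕ.< c → i ↓ a * j ↓ b * l ↓ c ≡ 0ℤ
    ↓-zero a b c (inj₁ i<a) rewrite n<a⇒n↓a≡0 i<a = refl
    ↓-zero a b c (inj₂ (inj₁ j<b)) rewrite n<a⇒n↓a≡0 j<b
      = cong (_* l ↓ c) (ℤ.*-zeroʳ (i ↓ a))
    ↓-zero a b c (inj₂ (inj₂ l<c)) rewrite n<a⇒n↓a≡0 l<c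
      = ℤ.*-zeroʳ (i ↓ a * j ↓ b)

  moment-low : ∀ n a b c → a ℕ.+ b ℕ.+ c ℕ.+ n ℕ.< i ℕ.+ j ℕ.+ l → moment n a b c ≡ 0ℤ
  moment-low zero a b c lt
    with sum₃-≤-split a b c i j l (ℕ.≤-trans (ℕ.m≤m+n (a ℕ.+ b ℕ.+ c) 0) (ℕ.<⇒≤ lt))
  ... | inj₁ (refl , refl , refl) = contradiction lt (ℕ.≤⇒≯ (ℕ.m≤m+n (a ℕ.+ b ℕ.+ c) 0))
  ... | inj₂ small = Λ-zero a b c small
  moment-low (suc n) a b c lt = begin
    moment (suc n) a b c
      ≡⟨ moment-suc n a b c ⟩
    moment n (suc a) b c + moment n a (suc b) c + moment n a b (suc c) + ρ * moment n a b c
      ≡⟨ cong₂ _+_ (cong₂ _+_ (cong₂ _+_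
           (moment-low n (suc a) b c (subst (ℕ._< N) (shift₁ a b c n) lt))
           (moment-low n a (suc b) c (subst (ℕ._< N) (shift₂ a b c n) lt)))
           (moment-low n a b (suc c) (subst (ℕ._< N) (shift₃ a b c n) lt)))
           (cong (ρ *_) (moment-low n a b c
             (ℕ.<-trans (ℕ.+-monoʳ-< (a ℕ.+ b ℕ.+ c) (ℕ.n<1+n n)) lt))) ⟩
    0ℤ + 0ℤ + 0ℤ + ρ * 0ℤ
      ≡⟨ trans (ℤ.+-identityˡ (ρ * 0ℤ)) (ℤ.*-zeroʳ ρ) ⟩
    0ℤ ∎
    where
    N = i ℕ.+ j ℕ.+ l
    ρ = - (σ + + suc n)

  moment-top : ∀ n a b c → a ℕ.+ b ℕ.+ c ℕ.+ n ≡ i ℕ.+ j ℕ.+ l →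
    moment n a b c ≡ τ₁ * τ₂ * τ₃ * (+ (n !) * (i ↓ a * j ↓ b * l ↓ c))
  moment-top zero a b c eq
    with sum₃-≡-split a b c i j l (trans (sym (ℕ.+-identityʳ (a ℕ.+ b ℕ.+ c))) eq)
  ... | inj₁ (refl , refl , refl) = begin
    moment 0 a b c
      ≡⟨ moment-0 a b c ⟩
    ⟨ X ⟩ (_^ a) * ⟨ Y ⟩ (_^ b) * ⟨ Z ⟩ (_^ c)
      ≡⟨ cong₂ _*_ (cong₂ _*_ X.top Y.top) Z.top ⟩
    (τ₁ * i ↓ i) * (τ₂ * j ↓ j) * (τ₃ * l ↓ l)
      ≡⟨ lemma τ₁ τ₂ τ₃ (i ↓ i) (j ↓ j) (l ↓ l) ⟩
    τ₁ * τ₂ * τ₃ * (1ℤ * (i ↓ i * j ↓ j * l ↓ l)) ∎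
    where
    lemma : ∀ s t u x y z →
      (s * x) * (t * y) * (u * z) ≡ s * t * u * (1ℤ * (x * y * z))
    lemma = solve-∀
  ... | inj₂ (small , large) = begin
    moment 0 a b c
      ≡⟨ Λ-zero a b c small ⟩
    0ℤ
      ≡⟨ ℤ.*-zeroʳ (τ₁ * τ₂ * τ₃) ⟨
    τ₁ * τ₂ * τ₃ * (1ℤ * 0ℤ)
      ≡⟨ cong (λ s → τ₁ * τ₂ * τ₃ * (1ℤ * s)) (↓-zero a b c large) ⟨
    τ₁ * τ₂ * τ₃ * (1ℤ * (i ↓ a * j ↓ b * l ↓ c)) ∎
  moment-top (suc n) a b c eq = begin
    moment (suc n) a b c
      ≡⟨ moment-suc n a b c ⟩
    moment n (suc a) b c + moment n a (suc b) c + moment n a b (suc c) + ρ * moment n a b c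
      ≡⟨ cong₂ _+_ (cong₂ _+_ (cong₂ _+_
           (moment-top n (suc a) b c (trans (sym (shift₁ a b c n)) eq))
           (moment-top n a (suc b) c (trans (sym (shift₂ a b c n)) eq)))
           (moment-top n a b (suc c) (trans (sym (shift₃ a b c n)) eq)))
           (cong (ρ *_) (moment-low n a b c
             (ℕ.<-≤-trans (ℕ.+-monoʳ-< (a ℕ.+ b ℕ.+ c) (ℕ.n<1+n n)) (ℕ.≤-reflexive eq)))) ⟩
    τ * (f * (i ↓ suc a * B * C)) + τ * (f * (A * j ↓ suc b * C))
      + τ * (f * (A * B * l ↓ suc c)) + ρ * 0ℤ
      ≡⟨ cong (_+ ρ * 0ℤ) (cong₂ _+_ (cong₂ _+_
           (cong (λ s → τ * (f * (s * B * C))) (↓-suc i a))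
           (cong (λ s → τ * (f * (A * s * C))) (↓-suc j b)))
           (cong (λ s → τ * (f * (A * B * s))) (↓-suc l c))) ⟩
    τ * (f * (A * (+ i - + a) * B * C)) + τ * (f * (A * (B * (+ j - + b)) * C))
      + τ * (f * (A * B * (C * (+ l - + c)))) + ρ * 0ℤ
      ≡⟨ collect τ f A B C (+ i) (+ j) (+ l) (+ a) (+ b) (+ c) ρ ⟩
    τ * ((+ i + + j + + l - (+ a + + b + + c)) * f * (A * B * C))
      -- By the degree condition `i - a`, `j - b` and `l - c` add up to `suc n`, the factor that
      -- extends `n !` to `suc n !`.
      ≡⟨ cong (λ s → τ * (s * f * (A * B * C))) (trans (cong (_- (+ a + + b + + c)) eqℤ)
           (cancel (+ a + + b + + c) (+ suc n))) ⟩
    τ * (+ suc n * f * (A * B * C))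
      ≡⟨ cong (λ s → τ * (s * (A * B * C))) (ℤ.pos-* (suc n) (n !)) ⟨
    τ * (+ (suc n !) * (A * B * C)) ∎
    where
    ρ = - (σ + + suc n)
    τ = τ₁ * τ₂ * τ₃
    f = + (n !)
    A = i ↓ a
    B = j ↓ b
    C = l ↓ c
    eqℤ : + i + + j + + l ≡ + a + + b + + c + + suc n
    eqℤ = cong +_ (sym eq)
    cancel : ∀ s t → s + t - s ≡ t
    cancel = solve-∀
    collect : ∀ τ f A B C i j l a b c ρ →
      τ * (f * (A * (i - a) * B * C)) + τ * (f * (A * (B * (j - b)) * C))
      + τ * (f * (A * B * (C * (l - c)))) + ρ * 0ℤ
      ≡ τ * ((i + j + l - (a + b + c)) * f * (A * B * C))
    collect = solve-∀

  -- In the cubic the two `x y z` terms cancel and six monomials remain, in pairs that are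
  -- antisymmetric in `x` and `y`. Each pair of top moments therefore contains the factor `i - j`.
  Λ-discriminant : ∀ n κ → 3 ℕ.+ n ≡ i ℕ.+ j ℕ.+ l →
    Λ (λ x y z → (x - y) * (κ * x - z) * (κ * y - z) * residueProduct n (x + y + z - σ)) ≡
    τ₁ * τ₂ * τ₃ * (+ (n !) * ((+ i - + j) *
      (κ * κ * (+ i * + j) - κ * (+ l * (+ i + + j - 1ℤ)) + + l * (+ l - 1ℤ))))
  Λ-discriminant n κ eq = begin
    Λ (λ x y z → (x - y) * (κ * x - z) * (κ * y - z) * r x y z)
      ≡⟨ Λ-cong (λ x y z → expand x y z κ (r x y z)) ⟩
    Λ (λ x y z → (κ * κ) * T 2 1 0 x y z + - (κ * κ) * T 1 2 0 x y z
               + - κ * T 2 0 1 x y z + κ * T 0 2 1 x y z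
               + 1ℤ * T 1 0 2 x y z + - 1ℤ * T 0 1 2 x y z)
      ≡⟨ linear ⟩
    (κ * κ) * M 2 1 0 + - (κ * κ) * M 1 2 0 + - κ * M 2 0 1 + κ * M 0 2 1
      + 1ℤ * M 1 0 2 + - 1ℤ * M 0 1 2
      ≡⟨ cong₂ _+_ (cong₂ _+_ (cong₂ _+_ (cong₂ _+_ (cong₂ _+_
           (cong ((κ * κ) *_) (top 2 1 0 eq)) (cong (- (κ * κ) *_) (top 1 2 0 eq)))
           (cong (- κ *_) (top 2 0 1 eq))) (cong (κ *_) (top 0 2 1 eq)))
           (cong (1ℤ *_) (top 1 0 2 eq))) (cong (- 1ℤ *_) (top 0 1 2 eq)) ⟩
    (κ * κ) * F 2 1 0 + - (κ * κ) * F 1 2 0 + - κ * F 2 0 1 + κ * F 0 2 1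
      + 1ℤ * F 1 0 2 + - 1ℤ * F 0 1 2
      ≡⟨ collect κ τ (+ (n !)) (+ i) (+ j) (+ l) ⟩
    τ * (+ (n !) * ((+ i - + j) *
      (κ * κ * (+ i * + j) - κ * (+ l * (+ i + + j - 1ℤ)) + + l * (+ l - 1ℤ)))) ∎
    where
    τ = τ₁ * τ₂ * τ₃
    r = λ x y z → residueProduct n (x + y + z - σ)
    T : ℕ → ℕ → ℕ → ℤ → ℤ → ℤ → ℤ
    T a b c x y z = monomial a b c x y z * r x y z
    M : ℕ → ℕ → ℕ → ℤ
    M = moment n
    -- For a variable `m` the small falling factorials do not unfold, so they are restated as
    -- polynomials in `+ m` for the final ring identity.
    _⇂_ : ℕ → ℕ → ℤ
    m ⇂ zero        = 1ℤ
    m ⇂ suc zero    = + m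
    m ⇂ suc (suc zero) = + m * (+ m - 1ℤ)
    m ⇂ suc (suc (suc a)) = m ↓ (3 ℕ.+ a)
    ↓-⇂ : ∀ m a → m ↓ a ≡ m ⇂ a
    ↓-⇂ m zero = refl
    ↓-⇂ m (suc zero) = trans (↓-suc m 0) (lemma (+ m))
      where
      lemma : ∀ m → 1ℤ * (m - 0ℤ) ≡ m
      lemma = solve-∀
    ↓-⇂ m (suc (suc zero)) = trans (↓-suc m 1) (cong (_* (+ m - 1ℤ)) (↓-⇂ m 1))
    ↓-⇂ m (suc (suc (suc a))) = refl
    F : ℕ → ℕ → ℕ → ℤ
    F a b c = τ * (+ (n !) * (i ⇂ a * j ⇂ b * l ⇂ c))
    linear : Λ (λ x y z → (κ * κ) * T 2 1 0 x y z + - (κ * κ) * T 1 2 0 x y z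
               + - κ * T 2 0 1 x y z + κ * T 0 2 1 x y z
               + 1ℤ * T 1 0 2 x y z + - 1ℤ * T 0 1 2 x y z) ≡
             (κ * κ) * M 2 1 0 + - (κ * κ) * M 1 2 0 + - κ * M 2 0 1 + κ * M 0 2 1
               + 1ℤ * M 1 0 2 + - 1ℤ * M 0 1 2
    linear = Λ-+* t₅ (- 1ℤ) (T 0 1 2)
            (Λ-+* t₄ 1ℤ (T 1 0 2)
            (Λ-+* t₃ κ (T 0 2 1)
            (Λ-+* t₂ (- κ) (T 2 0 1)
            (Λ-+* t₁ (- (κ * κ)) (T 1 2 0)
            (Λ-*ˡ (κ * κ) (T 2 1 0))))))
      where
      t₁ t₂ t₃ t₄ t₅ : ℤ → ℤ → ℤ → ℤ
      t₁ x y z = (κ * κ) * T 2 1 0 x y z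
      t₂ x y z = t₁ x y z + - (κ * κ) * T 1 2 0 x y z
      t₃ x y z = t₂ x y z + - κ * T 2 0 1 x y z
      t₄ x y z = t₃ x y z + κ * T 0 2 1 x y z
      t₅ x y z = t₄ x y z + 1ℤ * T 1 0 2 x y z
    top : ∀ a b c → a ℕ.+ b ℕ.+ c ℕ.+ n ≡ i ℕ.+ j ℕ.+ l → M a b c ≡ F a b c
    top a b c eq = trans (moment-top n a b c eq)
      (cong (λ s → τ * (+ (n !) * s))
        (cong₂ _*_ (cong₂ _*_ (↓-⇂ i a) (↓-⇂ j b)) (↓-⇂ l c)))
    expand : ∀ x y z κ r → (x - y) * (κ * x - z) * (κ * y - z) * r ≡
      (κ * κ) * ((x * (x * 1ℤ)) * (y * 1ℤ) * 1ℤ * r) + - (κ * κ) * ((x * 1ℤ) * (y * (y * 1ℤ)) * 1ℤ * r)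
      + - κ * ((x * (x * 1ℤ)) * 1ℤ * (z * 1ℤ) * r) + κ * (1ℤ * (y * (y * 1ℤ)) * (z * 1ℤ) * r)
      + 1ℤ * ((x * 1ℤ) * 1ℤ * (z * (z * 1ℤ)) * r) + - 1ℤ * (1ℤ * (y * 1ℤ) * (z * (z * 1ℤ)) * r)
    expand = solve-∀
    collect : ∀ κ τ f i j l →
      (κ * κ) * (τ * (f * (i * (i - 1ℤ) * j * 1ℤ))) + - (κ * κ) * (τ * (f * (i * (j * (j - 1ℤ)) * 1ℤ)))
      + - κ * (τ * (f * (i * (i - 1ℤ) * 1ℤ * l))) + κ * (τ * (f * (1ℤ * (j * (j - 1ℤ)) * l)))
      + 1ℤ * (τ * (f * (i * 1ℤ * (l * (l - 1ℤ))))) + - 1ℤ * (τ * (f * (1ℤ * j * (l * (l - 1ℤ)))))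
      ≡ τ * (f * ((i - j) * (κ * κ * (i * j) - κ * (l * (i + j - 1ℤ)) + l * (l - 1ℤ))))
    collect = solve-∀

-- Divisibility by a prime

infix 4 _∤_

_∤_ : ℕ → ℤ → Set
p ∤ x = ¬ + p ∣ x

module _ {p : ℕ} where

  n<p⇒p∤n : ∀ {n} .{{_ : NonZero n}} → n ℕ.< p → p ∤ + n
  n<p⇒p∤n n<p p∣n = contradiction (ℕ.∣⇒≤ (∣⇒∣ᵤ p∣n)) (ℕ.<⇒≱ n<p)

  ∣⟨⟩ : ∀ W {f} → All (λ x → + p ∣ f x) (points W) → + p ∣ ⟨ W ⟩ f
  ∣⟨⟩ []            []       = divides 0ℤ refl
  ∣⟨⟩ ((x , w) ∷ W) (d ∷ ds) = ∣m∣n⇒∣m+n (∣n⇒∣m*n w d) (∣⟨⟩ W ds)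

  ∣residueProduct : ∀ {s} n t → 0 ℕ.< t → t ℕ.≤ n → + p ∣ s - + t → + p ∣ residueProduct n s
  ∣residueProduct {s} (suc n) t 0<t t≤1+n d with ℕ.m≤n⇒m<n∨m≡n t≤1+n
  ... | inj₁ (s≤s t≤n) = ∣m⇒∣m*n (s - + suc n) (∣residueProduct n t 0<t t≤n d)
  ... | inj₂ refl      = ∣n⇒∣m*n (residueProduct n s) d
  ∣residueProduct zero    t 0<t t≤0 d = contradiction t≤0 (ℕ.<⇒≱ 0<t)

  -- The remainder of `s` lies between 1 and `p - 1`, so `s` minus its remainder is one of the
  -- factors.
  ∤⇒∣residueProduct : .{{_ : NonZero p}} → ∀ {s} → p ∤ s → + p ∣ residueProduct (ℕ.pred p) s
  ∤⇒∣residueProduct {s} p∤s = ∣residueProduct (ℕ.pred p) (s %ℕ p) 0<r r≤p-1 p∣s-r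
    where
    lemma : ∀ r q → (r + q) - r ≡ q
    lemma = solve-∀
    p∣s-r : + p ∣ s - + (s %ℕ p)
    p∣s-r = divides (s /ℕ p) (trans (cong (_- + (s %ℕ p)) (a≡a%ℕn+[a/ℕn]*n s p))
      (lemma (+ (s %ℕ p)) (s /ℕ p * + p)))
    r≤p-1 : s %ℕ p ℕ.≤ ℕ.pred p
    r≤p-1 = ℕ.<⇒≤pred (n%ℕd<d s p)
    0<r : 0 ℕ.< s %ℕ p
    0<r = ℕ.n≢0⇒n>0 λ r≡0 → p∤s
      (subst (+ p ∣_) (trans (cong (λ r → s - + r) r≡0) (ℤ.+-identityʳ s)) p∣s-r)

  module _ (p-prime : Prime p) where

    ∤-* : ∀ {x y} → p ∤ x → p ∤ y → p ∤ x * y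
    ∤-* {x} {y} p∤x p∤y p∣xy
      with euclidsLemma _ _ p-prime (subst (p ℕ.∣_) (ℤ.abs-* x y) (∣⇒∣ᵤ p∣xy))
    ... | inj₁ p∣x = p∤x (∣ᵤ⇒∣ p∣x)
    ... | inj₂ p∣y = p∤y (∣ᵤ⇒∣ p∣y)

    ∤-1 : p ∤ 1ℤ
    ∤-1 = n<p⇒p∤n (ℕ.nonTrivial⇒n>1 p {{prime⇒nonTrivial p-prime}})

    ∤-! : ∀ {n} → n ℕ.< p → p ∤ + (n !)
    ∤-! {zero}  n<p = ∤-1
    ∤-! {suc n} n<p rewrite ℤ.pos-* (suc n) (n !) =
      ∤-* (n<p⇒p∤n n<p) (∤-! (ℕ.<-trans (ℕ.n<1+n n) n<p))

    ∤-nodal : ∀ {a xs} → All (λ x → p ∤ x - a) xs → p ∤ nodal a xs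
    ∤-nodal []       = ∤-1
    ∤-nodal (d ∷ ds) = ∤-* d (∤-nodal ds)

    Incongruent : List ℤ → Set
    Incongruent = AllPairs λ x y → p ∤ y - x

    ∤-vandermonde : ∀ {a as} → Incongruent (a ∷ as) → p ∤ vandermonde a as
    ∤-vandermonde {as = []}     _             = ∤-1
    ∤-vandermonde {as = b ∷ bs} (a≢as ∷ as≢) = ∤-* (∤-nodal a≢as) (∤-vandermonde as≢)

    topFunctional : ∀ {d} xs → length xs ≡ suc d → Incongruent xs →
      ∃[ W ] ∃[ τ ] points W ≡ xs × IsTop d τ W × p ∤ τ
    topFunctional (a ∷ as) refl distinct =
      dividedDifference a as , vandermonde a as , points-dividedDifference a as ,
      dividedDifference-isTop a as , ∤-vandermonde distinct

    discriminant : ℕ → ℕ → ℕ → ℤ → ℤ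
    discriminant i j l κ =
      κ * κ * (+ i * + j) - κ * (+ l * (+ i + + j - 1ℤ)) + + l * (+ l - 1ℤ)

    -- A form of the Combinatorial Nullstellensatz. The polynomial has degree `3 + (p - 1)` and is
    -- divisible by `p` at every grid point, hence so is its value under the product functional.
    -- There `τ₁`, `τ₂`, `τ₃`, `(p - 1)!` and `i - j` are prime to `p`, which leaves the
    -- discriminant.
    grid-vanishing : .{{_ : NonZero p}} → ∀ {i j l} xs ys zs κ σ →
      length xs ≡ suc i → length ys ≡ suc j → length zs ≡ suc l →
      Incongruent xs → Incongruent ys → Incongruent zs →
      2 ℕ.+ p ≡ i ℕ.+ j ℕ.+ l →
      (∀ x y z → x ∈ₗ xs → y ∈ₗ ys → z ∈ₗ zs →
        + p ∣ (x - y) * (κ * x - z) * (κ * y - z) ⊎ p ∤ x + y + z - σ) →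
      p ∤ + i - + j → + p ∣ discriminant i j l κ
    grid-vanishing {i} {j} {l} xs ys zs κ σ |xs| |ys| |zs| xs≢ ys≢ zs≢ eq grid p∤i-j
      with topFunctional xs |xs| xs≢ | topFunctional ys |ys| ys≢ | topFunctional zs |zs| zs≢
    ... | X , τ₁ , refl , X-top , p∤τ₁ | Y , τ₂ , refl , Y-top , p∤τ₂ | Z , τ₃ , refl , Z-top , p∤τ₃
      with + p ∣? discriminant i j l κ
    ... | yes p∣D = p∣D
    ... | no  p∤D = contradiction
      (subst (+ p ∣_) (Λ-discriminant (ℕ.pred p) κ (trans (cong (2 ℕ.+_) (ℕ.suc-pred p)) eq)) p∣Λ)
      (∤-* (∤-* (∤-* p∤τ₁ p∤τ₂) p∤τ₃)
           (∤-* (∤-! (ℕ.≤-reflexive (ℕ.suc-pred p))) (∤-* p∤i-j p∤D)))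
      where
      open Moments X Y Z X-top Y-top Z-top σ
      p∣Λ : + p ∣ Λ λ x y z →
        (x - y) * (κ * x - z) * (κ * y - z) * residueProduct (ℕ.pred p) (x + y + z - σ)
      p∣Λ = ∣⟨⟩ X (All.tabulate λ {x} x∈ → ∣⟨⟩ Y (All.tabulate λ {y} y∈ →
        ∣⟨⟩ Z (All.tabulate λ {z} z∈ → vanish x y z (grid x y z x∈ y∈ z∈))))
        where
        vanish : ∀ x y z →
          + p ∣ (x - y) * (κ * x - z) * (κ * y - z) ⊎ p ∤ x + y + z - σ →
          + p ∣ (x - y) * (κ * x - z) * (κ * y - z) * residueProduct (ℕ.pred p) (x + y + z - σ)
        vanish x y z (inj₁ p∣V) = ∣m⇒∣m*n (residueProduct (ℕ.pred p) (x + y + z - σ)) p∣V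
        vanish x y z (inj₂ p∤s) =
          ∣n⇒∣m*n ((x - y) * (κ * x - z) * (κ * y - z)) (∤⇒∣residueProduct p∤s)

-- Subsets of Fin n

elements : Subset n → List (Fin n)
elements []            = []
elements (inside  ∷ A) = zero ∷ map suc (elements A)
elements (outside ∷ A) = map suc (elements A)

length-elements : (A : Subset n) → length (elements A) ≡ ∣ A ∣
length-elements []            = refl
length-elements (inside  ∷ A) =
  cong suc (trans (List.length-map suc (elements A)) (length-elements A))
length-elements (outside ∷ A) =
  trans (List.length-map suc (elements A)) (length-elements A)

∈-elements⁻ : (A : Subset n) → All (_∈ A) (elements A)
∈-elements⁻ []            = []
∈-elements⁻ (inside  ∷ A) = here ∷ All.map⁺ (All.map there (∈-elements⁻ A))
∈-elements⁻ (outside ∷ A) = All.map⁺ (All.map there (∈-elements⁻ A))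

elements-unique : (A : Subset n) → AllPairs _≢_ (elements A)
elements-unique []            = []
elements-unique (inside  ∷ A) =
  All.map⁺ (All.map (λ _ ()) (∈-elements⁻ A)) ∷
  AllPairs.map⁺ (AllPairs.map (_∘ Fin.suc-injective) (elements-unique A))
elements-unique (outside ∷ A) =
  AllPairs.map⁺ (AllPairs.map (_∘ Fin.suc-injective) (elements-unique A))

shrink : ∀ m (A : Subset n) → m ℕ.≤ ∣ A ∣ → ∃[ B ] B ⊆ A × ∣ B ∣ ≡ m
shrink zero    []            _         = [] , (λ ()) , refl
shrink m       (outside ∷ A) m≤        with shrink m A m≤
... | B , B⊆A , |B| = outside ∷ B , out⊆ B⊆A , |B|
shrink zero    (inside  ∷ A) _         with shrink zero A z≤n
... | B , B⊆A , |B| = outside ∷ B , out⊆ B⊆A , |B|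
shrink (suc m) (inside  ∷ A) (s≤s m≤)  with shrink m A m≤
... | B , B⊆A , |B| = inside ∷ B , s⊆s B⊆A , cong suc |B|

⊆∧∣∣≡⇒≡ : {A B : Subset n} → A ⊆ B → ∣ A ∣ ≡ ∣ B ∣ → A ≡ B
⊆∧∣∣≡⇒≡ {A = []}          {[]}          _   _  = refl
⊆∧∣∣≡⇒≡ {A = inside  ∷ A} {inside  ∷ B} A⊆B eq =
  cong (inside ∷_) (⊆∧∣∣≡⇒≡ (drop-∷-⊆ A⊆B) (ℕ.suc-injective eq))
⊆∧∣∣≡⇒≡ {A = outside ∷ A} {outside ∷ B} A⊆B eq =
  cong (outside ∷_) (⊆∧∣∣≡⇒≡ (drop-∷-⊆ A⊆B) eq)
⊆∧∣∣≡⇒≡ {A = inside  ∷ A} {outside ∷ B} A⊆B eq = contradiction (A⊆B here) λ ()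
⊆∧∣∣≡⇒≡ {A = outside ∷ A} {inside  ∷ B} A⊆B eq =
  contradiction (p⊆q⇒∣p∣≤∣q∣ (drop-∷-⊆ {p = A} {q = B} A⊆B)) (ℕ.<⇒≱ (ℕ.≤-reflexive (sym eq)))

∣remove∣ : ∀ {A : Subset n} {i} → i ∈ A → ∣ A ∣ ≡ suc ∣ A [ i ]≔ outside ∣
∣remove∣ here                        = refl
∣remove∣ {A = inside  ∷ A} (there i∈A) = cong suc (∣remove∣ i∈A)
∣remove∣ {A = outside ∷ A} (there i∈A) = ∣remove∣ i∈A

remove-⊆ : ∀ (A : Subset n) i → A [ i ]≔ outside ⊆ A
remove-⊆ (s ∷ A) zero    (there j∈) = there j∈
remove-⊆ (s ∷ A) (suc i) here       = here
remove-⊆ (s ∷ A) (suc i) (there j∈) = there (remove-⊆ A i j∈)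

-- Written the way `∑` unfolds in `ℤ/ p ℤ`, so that `total B ι` is `∑ B` by definition.
total : Subset n → (Fin n → ℤ) → ℤ
total A f = Vector.foldr _+_ 0ℤ λ i → if lookup A i then f i else 0ℤ

total-cong : ∀ (A : Subset n) {f g} → (∀ i → f i ≡ g i) → total A f ≡ total A g
total-cong []            f≗g = refl
total-cong (inside  ∷ A) f≗g = cong₂ _+_ (f≗g zero) (total-cong A (f≗g ∘ suc))
total-cong (outside ∷ A) f≗g = cong (λ s → 0ℤ + s) (total-cong A (f≗g ∘ suc))

total-remove : ∀ {A : Subset n} {i} f → i ∈ A →
  total A f ≡ f i + total (A [ i ]≔ outside) f
total-remove {A = inside ∷ A} f here =
  cong (λ s → f zero + s) (sym (ℤ.+-identityˡ (total A (f ∘ suc))))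
total-remove {A = s ∷ A} {suc i} f (there i∈A) = begin
  x + total A (f ∘ suc)
    ≡⟨ cong (λ s → x + s) (total-remove (f ∘ suc) i∈A) ⟩
  x + (f (suc i) + total (A [ i ]≔ outside) (f ∘ suc))
    ≡⟨ lemma x (f (suc i)) _ ⟩
  f (suc i) + (x + total (A [ i ]≔ outside) (f ∘ suc)) ∎
  where
  x = if s then f zero else 0ℤ
  lemma : ∀ x y z → x + (y + z) ≡ y + (x + z)
  lemma = solve-∀

ι : Fin n → ℤ
ι i = + toℕ i

-- Sets of integers whose mean lies outside them

total-1+ : ∀ (A : Subset n) f → total A (λ i → 1ℤ + f i) ≡ + ∣ A ∣ + total A f
total-1+ []            f = refl
total-1+ (inside  ∷ A) f = begin
  1ℤ + f zero + total A (λ i → 1ℤ + f (suc i))   ≡⟨ cong (λ s → 1ℤ + f zero + s) (total-1+ A (f ∘ suc)) ⟩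
  1ℤ + f zero + (+ ∣ A ∣ + total A (f ∘ suc))    ≡⟨ lemma (f zero) (+ ∣ A ∣) (total A (f ∘ suc)) ⟩
  1ℤ + + ∣ A ∣ + (f zero + total A (f ∘ suc))    ∎
  where
  lemma : ∀ x a t → 1ℤ + x + (a + t) ≡ 1ℤ + a + (x + t)
  lemma = solve-∀
total-1+ (outside ∷ A) f = begin
  0ℤ + total A (λ i → 1ℤ + f (suc i))       ≡⟨ cong (λ s → 0ℤ + s) (total-1+ A (f ∘ suc)) ⟩
  0ℤ + (+ ∣ A ∣ + total A (f ∘ suc))        ≡⟨ lemma (+ ∣ A ∣) (total A (f ∘ suc)) ⟩
  + ∣ A ∣ + (0ℤ + total A (f ∘ suc))        ∎
  where
  lemma : ∀ a t → 0ℤ + (a + t) ≡ a + (0ℤ + t)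
  lemma = solve-∀

total-∷ʳ : ∀ (A : Subset n) f →
  total (A ∷ʳ inside) f ≡ total A (f ∘ inject₁) + f (fromℕ n)
total-∷ʳ []      f = ℤ.+-comm (f zero) 0ℤ
total-∷ʳ {suc n} (s ∷ A) f = begin
  x + total (A ∷ʳ inside) (f ∘ suc)
    ≡⟨ cong (λ t → x + t) (total-∷ʳ A (f ∘ suc)) ⟩
  x + (total A (f ∘ suc ∘ inject₁) + f (suc (fromℕ n)))
    ≡⟨ ℤ.+-assoc x (total A (f ∘ suc ∘ inject₁)) (f (suc (fromℕ n))) ⟨
  x + total A (f ∘ suc ∘ inject₁) + f (suc (fromℕ n)) ∎
  where x = if s then f zero else 0ℤ

∣∷ʳ∣ : ∀ (A : Subset n) → ∣ A ∷ʳ inside ∣ ≡ suc ∣ A ∣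
∣∷ʳ∣ []            = refl
∣∷ʳ∣ (inside  ∷ A) = cong suc (∣∷ʳ∣ A)
∣∷ʳ∣ (outside ∷ A) = ∣∷ʳ∣ A

∷ʳ-inject₁ : ∀ {A : Subset n} {i s t} → A [ i ]= s → (A ∷ʳ t) [ inject₁ i ]= s
∷ʳ-inject₁ here      = here
∷ʳ-inject₁ (there e) = there (∷ʳ-inject₁ e)

-- The mean is prescribed exactly over the integers and not modulo `p`, so these sets can be built
-- independently of the prime and then moved into `Fin p`.
record Punctured (n k : ℕ) (c : Fin n) : Set where
  field
    subset : Subset n
    size   : ∣ subset ∣ ≡ k
    hole   : subset [ c ]= outside
    mean   : total subset ι ≡ + k * ι c

shift-total : ∀ {k} {c : Fin n} (A : Subset n) → ∣ A ∣ ≡ k → total A ι ≡ + k * ι c →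
  total A (ι ∘ suc) ≡ + k * (1ℤ + ι c)
shift-total {k = k} {c = c} A refl eq = begin
  total A (λ i → 1ℤ + ι i)   ≡⟨ total-1+ A ι ⟩
  + k + total A ι            ≡⟨ cong (λ s → + k + s) eq ⟩
  + k + + k * ι c            ≡⟨ lemma (+ k) (ι c) ⟩
  + k * (1ℤ + ι c)           ∎
  where
  lemma : ∀ k c → k + k * c ≡ k * (1ℤ + c)
  lemma = solve-∀

-- An absent element in front translates the set and its mean together by one.
pad : ∀ {k c} → Punctured n k c → Punctured (suc n) k (suc c)
pad {k = k} {c} P = record
  { subset = outside ∷ subset
  ; size   = size
  ; hole   = there hole
  ; mean   = trans (ℤ.+-identityˡ (total subset (ι ∘ suc))) (shift-total {c = c} subset size mean)
  }
  where open Punctured P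

-- The set gains both ends of the longer interval. Since `c` is the midpoint, the new elements `0`
-- and `n + 1` add up to twice the shifted centre and leave the mean there.
enlarge : ∀ {k c} → n ≡ suc (toℕ c ℕ.+ toℕ c) → Punctured n k c →
  Punctured (2 ℕ.+ n) (2 ℕ.+ k) (suc (inject₁ c))
enlarge {n} {k} {c} centred P = record
  { subset = inside ∷ (subset ∷ʳ inside)
  ; size   = cong suc (trans (∣∷ʳ∣ subset) (cong suc size))
  ; hole   = there (∷ʳ-inject₁ hole)
  ; mean   = begin
      0ℤ + total (subset ∷ʳ inside) (ι ∘ suc)
        ≡⟨ ℤ.+-identityˡ (total (subset ∷ʳ inside) (ι ∘ suc)) ⟩
      total (subset ∷ʳ inside) (ι ∘ suc)
        ≡⟨ total-∷ʳ subset (ι ∘ suc) ⟩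
      total subset (ι ∘ suc ∘ inject₁) + (1ℤ + ι (fromℕ n))
        ≡⟨ cong₂ (λ s m → s + (1ℤ + + m))
             (total-cong subset λ i → cong (λ m → 1ℤ + + m) (Fin.toℕ-inject₁ i))
             (trans (Fin.toℕ-fromℕ n) centred) ⟩
      total subset (ι ∘ suc) + (1ℤ + + suc (toℕ c ℕ.+ toℕ c))
        ≡⟨ cong (λ s → s + (1ℤ + + suc (toℕ c ℕ.+ toℕ c))) (shift-total {c = c} subset size mean) ⟩
      + k * (1ℤ + ι c) + (1ℤ + + suc (toℕ c ℕ.+ toℕ c))
        ≡⟨ lemma (+ k) (ι c) ⟩
      + (2 ℕ.+ k) * (1ℤ + ι c)
        ≡⟨ cong (λ m → + (2 ℕ.+ k) * (1ℤ + + m)) (Fin.toℕ-inject₁ c) ⟨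
      + (2 ℕ.+ k) * (1ℤ + ι (inject₁ c)) ∎
  }
  where
  open Punctured P
  lemma : ∀ k c → k * (1ℤ + c) + (1ℤ + (1ℤ + (c + c))) ≡ (1ℤ + (1ℤ + k)) * (1ℤ + c)
  lemma = solve-∀

CentredPunctured : ℕ → ℕ → Set
CentredPunctured n k = ∃[ c ] n ≡ suc (toℕ c ℕ.+ toℕ c) × Punctured n k c

enlarge-centred : ∀ {k} → CentredPunctured n k → CentredPunctured (2 ℕ.+ n) (2 ℕ.+ k)
enlarge-centred {n} (c , centred , P) = suc (inject₁ c) , eq , enlarge centred P
  where
  eq : 2 ℕ.+ n ≡ suc (suc (toℕ (inject₁ c)) ℕ.+ suc (toℕ (inject₁ c)))
  eq rewrite Fin.toℕ-inject₁ c | ℕ.+-suc (toℕ c) (toℕ c) = cong (2 ℕ.+_) centred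

-- The odd construction needs three more places than the even one. The parity recorded with it later
-- rules out the single prime size, `3 + k`, at which it would not fit.
ParityPunctured : ℕ → Set
ParityPunctured k = CentredPunctured (1 ℕ.+ k) k ⊎ CentredPunctured (4 ℕ.+ k) k × 2 ℕ.∣ suc k

enlarge-parity : ∀ {k} → ParityPunctured k → ParityPunctured (2 ℕ.+ k)
enlarge-parity (inj₁ P)           = inj₁ (enlarge-centred P)
enlarge-parity (inj₂ (P , 2∣1+k)) = inj₂ (enlarge-centred P , ℕ.∣m∣n⇒∣m+n (ℕ.divides 1 refl) 2∣1+k)

-- For even k, all of [-k/2 , k/2] except 0; for odd k, {-3 , 1 , 2} inside a
-- symmetric set.
parityPunctured : ∀ k → k ≢ 1 → ParityPunctured k
parityPunctured 0 _   = inj₁ (zero , refl , record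
  { subset = outside ∷ [] ; size = refl ; hole = here ; mean = refl })
parityPunctured 1 1≢1 = contradiction refl 1≢1
parityPunctured 2 _   = enlarge-parity (parityPunctured 0 (λ ()))
parityPunctured 3 _   = inj₂ ((suc (suc (suc zero)) , refl , record
  { subset = inside ∷ outside ∷ outside ∷ outside ∷ inside ∷ inside ∷ outside ∷ []
  ; size = refl ; hole = there (there (there here)) ; mean = refl }) , ℕ.divides 2 refl)
parityPunctured (suc (suc k@(suc (suc _)))) _ = enlarge-parity (parityPunctured k (λ ()))

pad-to : ∀ {k m} → m ℕ.≤ n → ∃[ c ] Punctured m k c → ∃[ c ] Punctured n k c
pad-to m≤n P = go (ℕ.≤⇒≤′ m≤n) P
  where
  go : ∀ {k m n} → m ℕ.≤′ n → ∃[ c ] Punctured m k c → ∃[ c ] Punctured n k c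
  go (ℕ.≤′-reflexive refl) P = P
  go (ℕ.≤′-step m≤n)       P with go m≤n P
  ... | c , P′ = suc c , pad P′

-- The difference lies between 1 and 6.
small-∤ : ∀ {p e} m → 2 ℕ.≤ m → m ℕ.≤ 6 → e ℕ.≤ 1 → 7 ℕ.≤ p → p ∤ + m - + e
small-∤ {e = 0} (suc (suc m)) _ m≤6 _ 7≤p
  rewrite ℤ.+-identityʳ (+ suc (suc m)) = n<p⇒p∤n (ℕ.≤-trans (s≤s m≤6) 7≤p)
small-∤ {e = 1} (suc (suc m)) _ m≤6 _ 7≤p =
  n<p⇒p∤n (ℕ.≤-trans m≤6 (ℕ.≤-trans (ℕ.n≤1+n 6) 7≤p))
small-∤ {e = suc (suc e)} _ _ _ (s≤s ()) _
small-∤ 1 (s≤s ())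

-- Barycentric subsets of the integers modulo `p`

module _ (p : ℕ) .{{_ : NonZero p}} (p-prime : Prime p) where

  private
    module G = FiniteAbelianGroup (ℤ/ p ℤ)

  ·≡* : ∀ m x → m G.· x ≡ + m * x
  ·≡* zero    x = refl
  ·≡* (suc m) x = trans (cong (λ s → x + s) (·≡* m x)) (lemma x (+ m))
    where
    lemma : ∀ x m → x + m * x ≡ (1ℤ + m) * x
    lemma = solve-∀

  ι-incongruent : ∀ {i j : Fin p} → i ≢ j → p ∤ ι j - ι i
  ι-incongruent {i} {j} i≢j d = i≢j (sym (trans (sym (inv j))
    (trans (Inverse.from-cong G.enumeration (congruent {ι j} {ι i} d)) (inv i))))
    where inv = Inverse.strictlyInverseʳ G.enumeration

  odd : 7 ℕ.≤ p → ¬ 2 ℕ.∣ p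
  odd 7≤p 2∣p with prime⇒irreducible p-prime 2∣p
  ... | inj₂ refl = contradiction 7≤p λ { (s≤s (s≤s ())) }

  punctured : ∀ {k} → 7 ℕ.≤ p → k ≢ 1 → 3 ℕ.+ k ℕ.≤ p → ∃[ c ] Punctured p k c
  punctured {k} 7≤p k≢1 3+k≤p with parityPunctured k k≢1
  ... | inj₁ (c , _ , P) = pad-to (ℕ.≤-trans (ℕ.m≤n+m (suc k) 2) 3+k≤p) (c , P)
  -- Were `p` equal to `3 + k` with `k` odd, it would be even; hence `4 + k ≤ p`.
  ... | inj₂ ((c , _ , P) , 2∣1+k) = pad-to (ℕ.≤∧≢⇒< 3+k≤p λ { refl →
    odd 7≤p (ℕ.∣m∣n⇒∣m+n (ℕ.divides 1 refl) 2∣1+k) }) (c , P)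

  module _ (k : ℕ) where

    -- A subset of size `k` is the whole set, with sum `k c`. If this were congruent to `k j`,
    -- cancelling `k` would give `j = c`, but `c` is the hole.
    punctured⇒¬barycentric : p ∤ + k → ∀ {c} (P : Punctured p k c) →
      ¬ HasBarycentricSubset (ℤ/ p ℤ) k (Punctured.subset P)
    punctured⇒¬barycentric p∤k {c} P (B , B⊆A , |B| , j , j∈B , congruent p∣)
      with ⊆∧∣∣≡⇒≡ B⊆A (trans |B| (sym (Punctured.size P)))
    ... | refl with j Fin.≟ c
    ...   | yes refl = contradiction ([]=-injective j∈B (Punctured.hole P)) λ ()
    ...   | no  j≢c  = ∤-* p-prime p∤k (ι-incongruent j≢c) (subst (+ p ∣_) eq p∣)
      where
      lemma : ∀ k c j → k * c - k * j ≡ k * (c - j)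
      lemma = solve-∀
      eq : total B ι - k G.· ι j ≡ + k * (ι c - ι j)
      eq = trans (cong₂ _-_ (Punctured.mean P) (·≡* k (ι j))) (lemma (+ k) (ι c) (ι j))

    -- Otherwise `A` without `a` and `b` would be barycentric with barycentre `c`: `a ≢ b` makes its
    -- size exactly `k`, and the other two inequalities keep `c` in it.
    ∤-exchange : ∀ {A a b c} → ∣ A ∣ ≡ 2 ℕ.+ k →
      ¬ HasBarycentricSubset (ℤ/ p ℤ) k A → a ∈ A → b ∈ A → c ∈ A →
      a ≢ b → a ≢ c → b ≢ c → p ∤ ι a + ι b + + k * ι c - total A ι
    ∤-exchange {A} {a} {b} {c} |A| none a∈A b∈A c∈A a≢b a≢c b≢c p∣ = none
      (B , B⊆A , ℕ.suc-injective (trans (sym (∣remove∣ b∈A′)) (ℕ.suc-injective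
        (trans (sym (∣remove∣ a∈A)) |A|))) ,
       c , []≔-minimal A′ c b (b≢c ∘ sym) ([]≔-minimal A c a (a≢c ∘ sym) c∈A) ,
       congruent (subst (+ p ∣_) eq (∣m⇒∣-m p∣)))
      where
      A′ = A [ a ]≔ outside
      B  = A′ [ b ]≔ outside
      b∈A′ : b ∈ A′
      b∈A′ = []≔-minimal A b a (a≢b ∘ sym) b∈A
      B⊆A : B ⊆ A
      B⊆A = ⊆-trans (remove-⊆ A′ b) (remove-⊆ A a)
      lemma : ∀ a b c k s → - (a + b + k * c - (a + (b + s))) ≡ s - k * c
      lemma = solve-∀
      eq : - (ι a + ι b + + k * ι c - total A ι) ≡ total B ι - k G.· ι c
      eq = begin
        - (ι a + ι b + + k * ι c - total A ι)
          ≡⟨ cong (λ s → - (ι a + ι b + + k * ι c - s))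
               (trans (total-remove ι a∈A) (cong (λ s → ι a + s) (total-remove ι b∈A′))) ⟩
        - (ι a + ι b + + k * ι c - (ι a + (ι b + total B ι)))
          ≡⟨ lemma (ι a) (ι b) (ι c) (+ k) (total B ι) ⟩
        total B ι - + k * ι c
          ≡⟨ cong (λ s → total B ι - s) (·≡* k (ι c)) ⟨
        total B ι - k G.· ι c ∎

    -- The grid has `i + 1` and `j + 1` elements of `A` on the first two axes and all `k + 2`
    -- multiples `k c` on the third, which are incongruent because `p` does not divide `k`.
    ∣discriminant : p ∤ + k → ∀ {A} → ∣ A ∣ ≡ 2 ℕ.+ k →
      ¬ HasBarycentricSubset (ℤ/ p ℤ) k A →
      ∀ i j → i ℕ.≤ suc k → j ℕ.≤ suc k → 2 ℕ.+ p ≡ i ℕ.+ j ℕ.+ suc k → p ∤ + i - + j →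
      + p ∣ discriminant p-prime i j (suc k) (+ k)
    ∣discriminant p∤k {A} |A| none i j i≤1+k j≤1+k eq p∤i-j
      with shrink (suc i) A (ℕ.≤-trans (s≤s i≤1+k) (ℕ.≤-reflexive (sym |A|)))
         | shrink (suc j) A (ℕ.≤-trans (s≤s j≤1+k) (ℕ.≤-reflexive (sym |A|)))
    ... | X , X⊆A , |X| | Y , Y⊆A , |Y| =
      grid-vanishing p-prime (grid X ι) (grid Y ι) (grid A κι) (+ k) (total A ι)
        (trans (length-grid X ι) |X|) (trans (length-grid Y ι) |Y|)
        (trans (length-grid A κι) |A|)
        (incongruent X ι ι-incongruent) (incongruent Y ι ι-incongruent)
        (incongruent A κι λ {a} {b} a≢b d →
          ∤-* p-prime p∤k (ι-incongruent a≢b) (subst (+ p ∣_) (factor (+ k) (ι b) (ι a)) d))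
        eq vanish p∤i-j
      where
      κι : Fin p → ℤ
      κι c = + k * ι c
      grid : Subset p → (Fin p → ℤ) → List ℤ
      grid B f = map f (elements B)
      length-grid : ∀ B f → length (grid B f) ≡ ∣ B ∣
      length-grid B f = trans (List.length-map f (elements B)) (length-elements B)
      incongruent : ∀ B f → (∀ {a b} → a ≢ b → p ∤ f b - f a) →
        Incongruent p-prime (grid B f)
      incongruent B f f≢ = AllPairs.map⁺ (AllPairs.map f≢ (elements-unique B))
      factor : ∀ k b a → k * b - k * a ≡ k * (b - a)
      factor = solve-∀
      ∈-grid⁻ : ∀ B f {x} → x ∈ₗ grid B f → ∃[ a ] a ∈ B × x ≡ f a
      ∈-grid⁻ B f x∈ with ∈-map⁻ f x∈
      ... | a , a∈ , eq = a , All.lookup (∈-elements⁻ B) a∈ , eq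
      V : ℤ → ℤ → ℤ → ℤ
      V x y z = (x - y) * (+ k * x - z) * (+ k * y - z)
      vanish : ∀ x y z → x ∈ₗ grid X ι → y ∈ₗ grid Y ι → z ∈ₗ grid A κι →
        + p ∣ V x y z ⊎ p ∤ x + y + z - total A ι
      vanish x y z x∈ y∈ z∈ with ∈-grid⁻ X ι x∈ | ∈-grid⁻ Y ι y∈ | ∈-grid⁻ A κι z∈
      ... | a , a∈ , refl | b , b∈ , refl | c , c∈ , refl
        -- Each coincidence of indices makes one factor of the cubic zero; distinct indices fall
        -- under `∤-exchange`.
        with a Fin.≟ b | a Fin.≟ c | b Fin.≟ c
      ... | yes refl | _ | _ = inj₁ (divides 0ℤ (zero₁ (ι a) (+ k * ι a - κι c) (+ k * ι a - κι c)))
        where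
        zero₁ : ∀ a s t → (a - a) * s * t ≡ 0ℤ
        zero₁ = solve-∀
      ... | no _ | yes refl | _ = inj₁ (divides 0ℤ (zero₂ (ι a - ι b) (κι a) (+ k * ι b - κι a)))
        where
        zero₂ : ∀ s a t → s * (a - a) * t ≡ 0ℤ
        zero₂ = solve-∀
      ... | no _ | no _ | yes refl = inj₁ (divides 0ℤ (zero₃ (ι a - ι b) (+ k * ι a - κι b) (κι b)))
        where
        zero₃ : ∀ s t a → s * t * (a - a) ≡ 0ℤ
        zero₃ = solve-∀
      ... | no a≢b | no a≢c | no b≢c =
        inj₂ (∤-exchange |A| none (X⊆A a∈) (Y⊆A b∈) c∈ a≢b a≢c b≢c)

    -- The discriminants at (3 + q , 1 + q + e) and (4 + q , q + e) differ by
    -- k² (3 - e), so p does not divide both.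
    forces : 7 ℕ.≤ p → p ∤ + k → ∀ q e → e ℕ.≤ 1 →
      suc p ≡ 4 ℕ.+ (q ℕ.+ q) ℕ.+ e ℕ.+ k → 3 ℕ.+ q ℕ.≤ k →
      Forces (ℤ/ p ℤ) k (2 ℕ.+ k)
    forces 7≤p p∤k q e e≤1 eq 3+q≤k A 2+k≤|A| =
      decidable-stable (hasBarycentricSubset? (ℤ/ p ℤ) k A) λ none →
        let B , B⊆A , |B| = shrink (2 ℕ.+ k) A 2+k≤|A|
            D = ∣discriminant p∤k |B|
                  (λ (C , C⊆B , C-barycentric) → none (C , ⊆-trans C⊆B B⊆A , C-barycentric))
        in ∤-* p-prime (∤-* p-prime p∤k p∤k) (small-∤ 3 (s≤s (s≤s z≤n)) (ℕ.m≤n+m 3 3) e≤1 7≤p)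
             -- Both pairs have the same sum `i + j = p + 1 - k`, as the top degree requires, so the
             -- discriminants differ only in the term with `i j`.
             (subst (+ p ∣_) (difference (+ k) (+ q) (+ e)) (∣m∣n⇒∣m-n
               (D (3 ℕ.+ q) (1 ℕ.+ (q ℕ.+ e)) (ℕ.m≤n⇒m≤1+n 3+q≤k)
                  (s≤s q+e≤k)
                  (trans (cong suc eq) (sum₁ q e k))
                  (small-∤ 2 ℕ.≤-refl (ℕ.m≤n+m 2 4) e≤1 7≤p ∘ subst (+ p ∣_) (gap₁ (+ q) (+ e))))
               (D (4 ℕ.+ q) (q ℕ.+ e) (s≤s 3+q≤k)
                  (ℕ.m≤n⇒m≤1+n q+e≤k)
                  (trans (cong suc eq) (sum₂ q e k))
                  (small-∤ 4 (s≤s (s≤s z≤n)) (ℕ.m≤n+m 4 2) e≤1 7≤p ∘ subst (+ p ∣_) (gap₂ (+ q) (+ e))))))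
      where
      q+e≤k : q ℕ.+ e ℕ.≤ k
      q+e≤k = ℕ.≤-trans (ℕ.+-monoʳ-≤ q (ℕ.≤-trans e≤1 (s≤s z≤n)))
        (ℕ.≤-trans (ℕ.≤-reflexive (ℕ.+-comm q 3)) 3+q≤k)
      gap₁ : ∀ q e → (+ 3 + q) - (1ℤ + (q + e)) ≡ + 2 - e
      gap₁ = solve-∀
      gap₂ : ∀ q e → (+ 4 + q) - (q + e) ≡ + 4 - e
      gap₂ = solve-∀
      sum₁ : ∀ q e k → suc (4 ℕ.+ (q ℕ.+ q) ℕ.+ e ℕ.+ k) ≡ 3 ℕ.+ q ℕ.+ (1 ℕ.+ (q ℕ.+ e)) ℕ.+ suc k
      sum₁ = ℕ-Solver.solve-∀
      sum₂ : ∀ q e k → suc (4 ℕ.+ (q ℕ.+ q) ℕ.+ e ℕ.+ k) ≡ 4 ℕ.+ q ℕ.+ (q ℕ.+ e) ℕ.+ suc k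
      sum₂ = ℕ-Solver.solve-∀
      difference : ∀ k q e →
        (k * k * ((+ 3 + q) * (1ℤ + (q + e)))
          - k * ((1ℤ + k) * ((+ 3 + q) + (1ℤ + (q + e)) - 1ℤ)) + (1ℤ + k) * ((1ℤ + k) - 1ℤ))
        - (k * k * ((+ 4 + q) * (q + e))
          - k * ((1ℤ + k) * ((+ 4 + q) + (q + e) - 1ℤ)) + (1ℤ + k) * ((1ℤ + k) - 1ℤ))
        ≡ k * k * (+ 3 - e)
      difference = solve-∀

-- Bounds on the least forcing size

bounds : ∀ (p k : ℕ) .{{_ : NonZero p}} → Prime p → 7 ℕ.≤ p →
  p ℕ.+ 2 ℕ.≤ 3 ℕ.* k → k ℕ.≤ p ℕ.∸ 3 →
  ∀ m → IsLeast (Forces (ℤ/ p ℤ) k) m → k ℕ.+ 1 ℕ.≤ m × m ℕ.≤ k ℕ.+ 2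
bounds p k p-prime 7≤p p+2≤3k k≤p∸3 m (m-forces , m-least) = lower , upper
  where
  k+3≤p : k ℕ.+ 3 ℕ.≤ p
  k+3≤p = ℕ.m≤o∸n⇒m+n≤o k (ℕ.≤-trans (s≤s (s≤s (s≤s z≤n))) 7≤p) k≤p∸3

  2<k : 2 ℕ.< k
  2<k = ℕ.*-cancelˡ-< 3 2 k (ℕ.<-≤-trans (ℕ.≤-trans 7≤p (ℕ.m≤m+n p 2)) p+2≤3k)

  p∤k : p ∤ + k
  p∤k = n<p⇒p∤n {{ℕ.>-nonZero (ℕ.<-trans (s≤s z≤n) 2<k)}}
    (ℕ.<-≤-trans (ℕ.m<m+n k (s≤s z≤n)) k+3≤p)

  lower : k ℕ.+ 1 ℕ.≤ m
  -- If `m ≤ k`, then `m` would force a barycentric subset in the punctured set of size `k`. Here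
  -- `2 < k` excludes `k = 1`, where no punctured set exists.
  lower = subst (ℕ._≤ m) (ℕ.+-comm 1 k) (ℕ.≰⇒> λ m≤k →
    let c , P = punctured p p-prime 7≤p (λ { refl → contradiction 2<k λ { (s≤s ()) } })
                  (subst (ℕ._≤ p) (ℕ.+-comm k 3) k+3≤p)
    in punctured⇒¬barycentric p p-prime k p∤k P (m-forces (Punctured.subset P)
         (ℕ.≤-trans m≤k (ℕ.≤-reflexive (sym (Punctured.size P))))))

  upper : m ℕ.≤ k ℕ.+ 2
  upper = m-least (k ℕ.+ 2) (subst (Forces (ℤ/ p ℤ) k) (ℕ.+-comm 2 k)
    (forces p p-prime k 7≤p p∤k q e (ℕ.s≤s⁻¹ (m%n<n s 2)) 1+p≡ 3+q≤k))
    where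
    -- The exponents must satisfy `i + j = p + 1 - k = s + 4`. Halving `s` as `2 q + e` makes them
    -- nearly equal, so that both stay within `k + 1`.
    s = p ℕ.∸ (k ℕ.+ 3)
    q = s / 2
    e = s % 2
    1+p≡ : suc p ≡ 4 ℕ.+ (q ℕ.+ q) ℕ.+ e ℕ.+ k
    1+p≡ = begin
      suc p                                      ≡⟨ cong suc (ℕ.m∸n+n≡m k+3≤p) ⟨
      suc (s ℕ.+ (k ℕ.+ 3))        ≡⟨ cong (λ s → suc (s ℕ.+ (k ℕ.+ 3))) (m≡m%n+[m/n]*n s 2) ⟩
      suc (e ℕ.+ q ℕ.* 2 ℕ.+ (k ℕ.+ 3))          ≡⟨ lemma q e k ⟩
      4 ℕ.+ (q ℕ.+ q) ℕ.+ e ℕ.+ k                ∎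
      where
      lemma : ∀ q e k → suc (e ℕ.+ q ℕ.* 2 ℕ.+ (k ℕ.+ 3)) ≡ 4 ℕ.+ (q ℕ.+ q) ℕ.+ e ℕ.+ k
      lemma = ℕ-Solver.solve-∀
    -- Since `p + 2 = 2 (2 + q) + 1 + e + k`, the hypothesis `p + 2 ≤ 3 k` gives this bound, which
    -- makes the largest exponent `4 + q` at most `k + 1`.
    2[2+q]<2k : 2 ℕ.* (2 ℕ.+ q) ℕ.< 2 ℕ.* k
    2[2+q]<2k = ℕ.+-cancelʳ-≤ k _ _ (ℕ.≤-trans (ℕ.m≤n+m _ e) (ℕ.≤-trans
      (ℕ.≤-reflexive (trans (lemma₁ q e k) (trans (cong suc (sym 1+p≡)) (ℕ.+-comm 2 p))))
      (ℕ.≤-trans p+2≤3k (ℕ.≤-reflexive (lemma₂ k)))))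
      where
      lemma₁ : ∀ q e k → e ℕ.+ (suc (2 ℕ.* (2 ℕ.+ q)) ℕ.+ k) ≡ suc (4 ℕ.+ (q ℕ.+ q) ℕ.+ e ℕ.+ k)
      lemma₁ = ℕ-Solver.solve-∀
      lemma₂ : ∀ k → 3 ℕ.* k ≡ 2 ℕ.* k ℕ.+ k
      lemma₂ = ℕ-Solver.solve-∀
    3+q≤k : 3 ℕ.+ q ℕ.≤ k
    3+q≤k = ℕ.*-cancelˡ-< 2 (2 ℕ.+ q) k 2[2+q]<2k

mainTheorem8 : ∀ (p k : ℕ) .{{_ : NonZero p}} → Prime p → 7 ℕ.≤ p →
    p ℕ.+ 2 ℕ.≤ 3 ℕ.* k → k ℕ.≤ p ℕ.∸ 3 →
    k ℕ.+ 1 ℕ.≤ BO k (ℤ/ p ℤ) × BO k (ℤ/ p ℤ) ℕ.≤ k ℕ.+ 2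
mainTheorem8 p k p-prime 7≤p p+2≤3k k≤p∸3 =
  bounds p k p-prime 7≤p p+2≤3k k≤p∸3 (BO k (ℤ/ p ℤ)) (BO-isLeast k (ℤ/ p ℤ))
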